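{- (a) For every integer $i\ge 1$ and every integer $m\ge i+1$, $$d_i^2(m)\bigl(d_i^2(m)-d_i(m-1)d_i(m+1)\bigr)>d_i^2(m-1)\bigl(d_i^2(m+1)-d_i(m)d_i(m+2)\bigr).$$ (b) For $i=0$ the reverse strict inequality holds: for every integer $m\ge 1$, $$d_0^2(m)\bigl(d_0^2(m)-d_0(m-1)d_0(m+1)\bigr)<d_0^2(m-1)\bigl(d_0^2(m+1)-d_0(m)d_0(m+2)\bigr).$$
   Context: For integers $m\ge 0$ and $0\le i\le m$, the Boros–Moll numbers are $$d_i(m)=2^{ -2m}\sum_{k=i}^{m}2^k\binom{2m-2k}{m-k}\binom{m+k}{k}\binom{k}{i}.$$ -}

module Defs where

open import Data.Integer.Base using (+_)
open import Data.List.Base using (map; upTo)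
open import Data.Nat.Base using (ℕ; suc; _+_; _*_; _∸_; _^_)
open import Data.Nat.Combinatorics using (_C_)
open import Data.Nat.ListAction using (sum)
open import Data.Nat.Properties using (m^n≢0)
open import Data.Rational.Base as ℚ using (ℚ; _/_)

-- f a + f (a + 1) + … + f b, both endpoints included; it is 0 when b < a.
∑[_⋯_] : ℕ → ℕ → (ℕ → ℕ) → ℕ
∑[ a ⋯ b ] f = sum (map (λ j → f (a + j)) (upTo (suc b ∸ a)))

-- The Boros–Moll number d_i(m). In every term of the sum k ≤ m, so the
-- truncated subtractions agree with the integer ones.
d : ℕ → ℕ → ℚ
d i m = _/_ (+ ∑[ i ⋯ m ] term) (2 ^ (2 * m)) {{m^n≢0 2 (2 * m)}}
  where
  term : ℕ → ℕ
  term k = 2 ^ k * ((2 * m ∸ 2 * k) C (m ∸ k)) * ((m + k) C k) * (k C i)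

infix 8 _²

_² : ℚ → ℚ
x ² = x ℚ.* x

{-# OPTIONS --safe #-}
module Submission where

-- Write d_i(m) = N(q) / 4ᵐ with q = m − i. Zeilberger's algorithm yields a three-term recurrence for N with
-- polynomial coefficients, and since all its terms can be kept non-negative, the telescoping takes place in ℕ.
-- Put n = q + i and define the excess h by (q + 1) N(q + 1) = 2 (4n + 3) N(q) + h(q). The recurrence becomes
-- (q + 1)(n + 1)(n + 2) h(q + 1) = 2β h(q) + 4 (4n + 3) i² N(q) with β ≥ 0, so h ≥ 0, and h = 0 for i = 0.
-- For i ≥ 1, induction improves this to (i² + n) h(q) ≥ 2i² N(q), with equality at q = 0.
-- The inequality is homogeneous of degree 4, with the powers of 4 balanced, so it is a statement about a binary
-- quartic form in N(q) and h(q). After the substitution i = 1 + j and (i² + n) h = 2i² N + e, the difference of the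
-- two sides is a polynomial in j, q, N, e without negative coefficients. For i = 0 it is a polynomial in q times N⁴,
-- without positive coefficients.

-- Polynomial inequalities over ℕ, decided coefficient by coefficient.

module CoefficientwiseComparison where
  open import Data.Bool.Base using (Bool; true; T; _∧_)
  open import Data.Bool.Properties using (T-∧)
  open import Data.Fin.Base using (Fin; zero; suc)
  open import Data.List.Base using (List; []; _∷_)
  open import Data.Nat.Base
  open import Data.Nat.Properties
  open import Data.Nat.Tactic.RingSolver using (solve-∀)
  open import Data.Product.Base using (proj₁; proj₂)
  open import Data.Vec.Base using (Vec; []; _∷_; lookup)
  open import Function.Bundles using (Equivalence)
  open import Relation.Binary.PropositionalEquality

  infixl 6 _:+_
  infixl 7 _:*_

  data Expr (n : ℕ) : Set where
    con       : ℕ → Expr n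
    var       : Fin n → Expr n
    _:+_ _:*_ : Expr n → Expr n → Expr n

  ⟦_⟧ : ∀ {n} → Expr n → Vec ℕ n → ℕ
  ⟦ con c ⟧ ρ = c
  ⟦ var x ⟧ ρ = lookup ρ x
  ⟦ a :+ b ⟧ ρ = ⟦ a ⟧ ρ + ⟦ b ⟧ ρ
  ⟦ a :* b ⟧ ρ = ⟦ a ⟧ ρ * ⟦ b ⟧ ρ

  -- Poly (suc n) lists the coefficients of the powers of the first variable,
  -- lowest degree first.
  Poly : ℕ → Set
  Poly zero    = ℕ
  Poly (suc n) = List (Poly n)

  eval : ∀ {n} → Poly n → Vec ℕ n → ℕ
  eval {zero}  c        ρ       = c
  eval {suc n} []       ρ       = 0
  eval {suc n} (p ∷ ps) (x ∷ ρ) = eval p ρ + x * eval ps (x ∷ ρ)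

  constant : ∀ n → ℕ → Poly n
  constant zero    c = c
  constant (suc n) c = constant n c ∷ []

  indeterminate : ∀ {n} → Fin n → Poly n
  indeterminate {suc n} zero    = constant n 0 ∷ constant n 1 ∷ []
  indeterminate {suc n} (suc x) = indeterminate x ∷ []

  add : ∀ {n} → Poly n → Poly n → Poly n
  add {zero}  a        b        = a + b
  add {suc n} []       qs       = qs
  add {suc n} (p ∷ ps) []       = p ∷ ps
  add {suc n} (p ∷ ps) (q ∷ qs) = add p q ∷ add ps qs

  mul : ∀ {n} → Poly n → Poly n → Poly n
  scale : ∀ {n} → Poly n → List (Poly n) → List (Poly n)
  mul {zero}  a        b  = a * b
  mul {suc n} []       qs = []
  mul {suc n} (p ∷ ps) qs = add {suc n} (scale p qs) (constant n 0 ∷ mul {suc n} ps qs)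
  scale p []       = []
  scale p (q ∷ qs) = mul p q ∷ scale p qs

  normalise : ∀ {n} → Expr n → Poly n
  normalise (con c) = constant _ c
  normalise (var x) = indeterminate x
  normalise (a :+ b) = add (normalise a) (normalise b)
  normalise (a :* b) = mul (normalise a) (normalise b)

  eval-constant : ∀ n c (ρ : Vec ℕ n) → eval (constant n c) ρ ≡ c
  eval-constant zero    c ρ       = refl
  eval-constant (suc n) c (x ∷ ρ) = trans (cong₂ _+_ (eval-constant n c ρ) (*-zeroʳ x)) (+-identityʳ c)

  eval-variable : ∀ {n} (x : Fin n) (ρ : Vec ℕ n) → eval (indeterminate x) ρ ≡ lookup ρ x
  eval-variable {suc n} zero (x ∷ ρ)
    rewrite eval-constant n 0 ρ | eval-constant n 1 ρ | *-zeroʳ x = *-identityʳ x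
  eval-variable {suc n} (suc y) (x ∷ ρ)
    rewrite *-zeroʳ x = trans (+-identityʳ _) (eval-variable y ρ)

  eval-add : ∀ {n} (p q : Poly n) ρ → eval (add p q) ρ ≡ eval p ρ + eval q ρ
  eval-add {zero}  a        b        ρ       = refl
  eval-add {suc n} []       qs       ρ       = refl
  eval-add {suc n} (p ∷ ps) []       ρ       = sym (+-identityʳ _)
  eval-add {suc n} (p ∷ ps) (q ∷ qs) (x ∷ ρ)
    rewrite eval-add p q ρ | eval-add {suc n} ps qs (x ∷ ρ) = interchange (eval p ρ) _ _ _ x
    where
    interchange : ∀ a b c d x → a + b + x * (c + d) ≡ a + x * c + (b + x * d)
    interchange = solve-∀

  eval-mul : ∀ {n} (p q : Poly n) ρ → eval (mul p q) ρ ≡ eval p ρ * eval q ρ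
  eval-scale : ∀ {n} (p : Poly n) qs x ρ →
    eval {suc n} (scale p qs) (x ∷ ρ) ≡ eval p ρ * eval {suc n} qs (x ∷ ρ)
  eval-mul {zero}  a        b  ρ       = refl
  eval-mul {suc n} []       qs ρ       = refl
  eval-mul {suc n} (p ∷ ps) qs (x ∷ ρ)
    rewrite eval-add {suc n} (scale p qs) (constant n 0 ∷ mul {suc n} ps qs) (x ∷ ρ)
          | eval-scale p qs x ρ
          | eval-constant n 0 ρ
          | eval-mul {suc n} ps qs (x ∷ ρ) = distrib (eval p ρ) _ _ x
    where
    distrib : ∀ a b c x → a * c + x * (b * c) ≡ (a + x * b) * c
    distrib = solve-∀
  eval-scale p []       x ρ = sym (*-zeroʳ (eval p ρ))
  eval-scale p (q ∷ qs) x ρ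
    rewrite eval-mul p q ρ | eval-scale p qs x ρ = distrib (eval p ρ) _ _ x
    where
    distrib : ∀ a b c x → a * b + x * (a * c) ≡ a * (b + x * c)
    distrib = solve-∀

  eval-normalise : ∀ {n} (a : Expr n) ρ → eval (normalise a) ρ ≡ ⟦ a ⟧ ρ
  eval-normalise (con c) ρ = eval-constant _ c ρ
  eval-normalise (var x) ρ = eval-variable x ρ
  eval-normalise (a :+ b) ρ = trans (eval-add (normalise a) (normalise b) ρ)
    (cong₂ _+_ (eval-normalise a ρ) (eval-normalise b ρ))
  eval-normalise (a :* b) ρ = trans (eval-mul (normalise a) (normalise b) ρ)
    (cong₂ _*_ (eval-normalise a ρ) (eval-normalise b ρ))

  -- Normal forms are not trimmed, so a longer left-hand list is accepted as long as its surplus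
  -- coefficients are zero.
  _≤ᶜ_ : ∀ {n} → Poly n → Poly n → Bool
  _≤ᶜ_ {zero}  a        b        = a ≤ᵇ b
  _≤ᶜ_ {suc n} []       qs       = true
  _≤ᶜ_ {suc n} (p ∷ ps) []       = (p ≤ᶜ constant n 0) ∧ (_≤ᶜ_ {suc n} ps [])
  _≤ᶜ_ {suc n} (p ∷ ps) (q ∷ qs) = (p ≤ᶜ q) ∧ (_≤ᶜ_ {suc n} ps qs)

  eval-mono : ∀ {n} (p q : Poly n) → T (p ≤ᶜ q) → ∀ ρ → eval p ρ ≤ eval q ρ
  eval-mono {zero}  a        b        p≤q ρ       = ≤ᵇ⇒≤ a b p≤q
  eval-mono {suc n} []       qs       p≤q ρ       = z≤n
  eval-mono {suc n} (p ∷ ps) []       p≤q (x ∷ ρ) = begin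
    eval p ρ + x * eval ps (x ∷ ρ) ≤⟨ +-mono-≤ (eval-mono p _ (proj₁ h) ρ) (*-monoʳ-≤ x (eval-mono {suc n} ps [] (proj₂ h) (x ∷ ρ))) ⟩
    eval (constant n 0) ρ + x * 0  ≡⟨ cong₂ _+_ (eval-constant n 0 ρ) (*-zeroʳ x) ⟩
    0                              ∎
    where
    open ≤-Reasoning
    h = Equivalence.to T-∧ p≤q
  eval-mono {suc n} (p ∷ ps) (q ∷ qs) p≤q (x ∷ ρ) =
    +-mono-≤ (eval-mono p q (proj₁ h) ρ) (*-monoʳ-≤ x (eval-mono {suc n} ps qs (proj₂ h) (x ∷ ρ)))
    where h = Equivalence.to T-∧ p≤q

  -- Variables take values in ℕ, so no monomial is negative and it suffices to compare coefficients.
  -- For closed expressions the hypothesis is a Boolean computation; when it succeeds, it reduces to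
  -- the unit type and `_` proves it.
  coefficientwise-≤ : ∀ {n} (a b : Expr n) → T (normalise a ≤ᶜ normalise b) →
    ∀ ρ → ⟦ a ⟧ ρ ≤ ⟦ b ⟧ ρ
  coefficientwise-≤ a b a≤b ρ =
    subst₂ _≤_ (eval-normalise a ρ) (eval-normalise b ρ) (eval-mono (normalise a) (normalise b) a≤b ρ)

-- Ratios of binomial coefficients, and Catalan numbers.

module Binomials where
  open import Data.Nat.Base
  open import Data.Nat.Combinatorics using (_C_; nCk≡n!/k![n-k]!; k![n∸k]!∣n!; nCn≡1)
  open import Data.Nat.DivMod using (m/n*n≡m)
  open import Data.Nat.Properties
  open import Data.Nat.Tactic.RingSolver using (solve-∀)
  open import Relation.Binary.PropositionalEquality
  open import Algebra.Properties.CommutativeSemigroup *-commutativeSemigroup using (x∙yz≈y∙xz)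
  open ≡-Reasoning

  opaque
    -- Indexing by the two lower parts `a` and `b` makes every neighbour reachable by a successor,
    -- without truncated subtraction. Opacity keeps it an atom instead of a quotient of factorials.
    binomial : ℕ → ℕ → ℕ
    binomial a b = (a + b) C b

    binomial≡C : ∀ a b → binomial a b ≡ (a + b) C b
    binomial≡C a b = refl

  binomial-! : ∀ a b → binomial a b * (b ! * a !) ≡ (a + b) !
  binomial-! a b = begin
    binomial a b * (b ! * a !)                                   ≡⟨ cong (λ x → binomial a b * (b ! * x !)) (m+n∸n≡m a b) ⟨
    binomial a b * (b ! * (a + b ∸ b) !)                         ≡⟨ cong (_* (b ! * (a + b ∸ b) !)) (trans (binomial≡C a b) (nCk≡n!/k![n-k]! (m≤n+m b a))) ⟩
    ((a + b) ! / (b ! * (a + b ∸ b) !)) * (b ! * (a + b ∸ b) !)  ≡⟨ m/n*n≡m (k![n∸k]!∣n! (m≤n+m b a)) ⟩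
    (a + b) !                                                    ∎
    where instance _ = b !* (a + b ∸ b) !≢0

  binomial≢0 : ∀ a b → NonZero (binomial a b)
  binomial≢0 a b = m*n≢0⇒m≢0 (binomial a b) {{subst NonZero (sym (binomial-! a b)) ((a + b) !≢0)}}

  binomial-sucʳ : ∀ a b → suc b * binomial a (suc b) ≡ suc (a + b) * binomial a b
  binomial-sucʳ a b = *-cancelʳ-≡ _ _ (b ! * a !) (begin
    suc b * binomial a (suc b) * (b ! * a !)    ≡⟨ shuffle (suc b) (binomial a (suc b)) (b !) (a !) ⟩
    binomial a (suc b) * (suc b ! * a !)        ≡⟨ binomial-! a (suc b) ⟩
    (a + suc b) !                               ≡⟨ cong _! (+-suc a b) ⟩
    suc (a + b) * (a + b) !                     ≡⟨ cong (suc (a + b) *_) (binomial-! a b) ⟨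
    suc (a + b) * (binomial a b * (b ! * a !))  ≡⟨ *-assoc (suc (a + b)) (binomial a b) (b ! * a !) ⟨
    suc (a + b) * binomial a b * (b ! * a !)    ∎)
    where
    instance _ = b !* a !≢0
    shuffle : ∀ s c x y → s * c * (x * y) ≡ c * (s * x * y)
    shuffle = solve-∀

  binomial-sucˡ : ∀ a b → suc a * binomial (suc a) b ≡ suc (a + b) * binomial a b
  binomial-sucˡ a b = *-cancelʳ-≡ _ _ (b ! * a !) (begin
    suc a * binomial (suc a) b * (b ! * a !)    ≡⟨ shuffle (suc a) (binomial (suc a) b) (b !) (a !) ⟩
    binomial (suc a) b * (b ! * suc a !)        ≡⟨ binomial-! (suc a) b ⟩
    suc (a + b) * (a + b) !                     ≡⟨ cong (suc (a + b) *_) (binomial-! a b) ⟨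
    suc (a + b) * (binomial a b * (b ! * a !))  ≡⟨ *-assoc (suc (a + b)) (binomial a b) (b ! * a !) ⟨
    suc (a + b) * binomial a b * (b ! * a !)    ∎)
    where
    instance _ = b !* a !≢0
    shuffle : ∀ s c x y → s * c * (x * y) ≡ c * (x * (s * y))
    shuffle = solve-∀

  binomial-0 : ∀ b → binomial 0 b ≡ 1
  binomial-0 b = trans (binomial≡C 0 b) (nCn≡1 b)

  central : ℕ → ℕ
  central j = binomial j j

  -- The path from `binomial j j` to `binomial (suc j) (suc j)` passes through `binomial (suc j) j`.
  -- Each half costs a factor `suc j`, and one of the two cancels against `2 * j + 2`.
  central-suc : ∀ j → suc j * central (suc j) ≡ 2 * (2 * j + 1) * central j
  central-suc j = *-cancelˡ-≡ _ _ (suc j) (begin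
    suc j * (suc j * binomial (suc j) (suc j))        ≡⟨ cong (suc j *_) (binomial-sucʳ (suc j) j) ⟩
    suc j * (suc (suc j + j) * binomial (suc j) j)    ≡⟨ x∙yz≈y∙xz (suc j) (suc (suc j + j)) (binomial (suc j) j) ⟩
    suc (suc j + j) * (suc j * binomial (suc j) j)    ≡⟨ cong (suc (suc j + j) *_) (binomial-sucˡ j j) ⟩
    suc (suc j + j) * (suc (j + j) * binomial j j)    ≡⟨ tidy j (central j) ⟩
    suc j * (2 * (2 * j + 1) * central j)             ∎)
    where
    tidy : ∀ j c → suc (suc j + j) * (suc (j + j) * c) ≡ suc j * (2 * (2 * j + 1) * c)
    tidy = solve-∀

  -- The Catalan numbers in ballot form, a difference of two entries of one row, which avoids
  -- division. Both `central j` and `central (suc j)` are polynomial multiples of `catalan j`, so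
  -- the certificate of the recurrence can be written without denominators.
  catalan : ℕ → ℕ
  catalan zero    = 1
  catalan (suc j) = central (suc j) ∸ binomial j (suc (suc j))

  central≡catalan : ∀ j → central j ≡ suc j * catalan j
  central≡catalan zero    = binomial-0 0
  central≡catalan (suc j) = sym (begin
    suc (suc j) * (central (suc j) ∸ binomial j (suc (suc j)))                  ≡⟨ *-distribˡ-∸ (suc (suc j)) (central (suc j)) (binomial j (suc (suc j))) ⟩
    suc (suc j) * central (suc j) ∸ suc (suc j) * binomial j (suc (suc j))      ≡⟨ cong (suc (suc j) * central (suc j) ∸_) next ⟩
    suc (suc j) * central (suc j) ∸ suc j * central (suc j)                     ≡⟨ m+n∸n≡m (central (suc j)) (suc j * central (suc j)) ⟩
    central (suc j)                                                             ∎)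
    where
    next : suc (suc j) * binomial j (suc (suc j)) ≡ suc j * central (suc j)
    next = trans (binomial-sucʳ j (suc j)) (sym (binomial-sucˡ j (suc j)))

  central-suc≡catalan : ∀ j → central (suc j) ≡ 2 * (2 * j + 1) * catalan j
  central-suc≡catalan j = *-cancelˡ-≡ _ _ (suc j) (begin
    suc j * central (suc j)                  ≡⟨ central-suc j ⟩
    2 * (2 * j + 1) * central j              ≡⟨ cong (2 * (2 * j + 1) *_) (central≡catalan j) ⟩
    2 * (2 * j + 1) * (suc j * catalan j)    ≡⟨ x∙yz≈y∙xz (2 * (2 * j + 1)) (suc j) (catalan j) ⟩
    suc j * (2 * (2 * j + 1) * catalan j)    ∎)

  catalan-suc : ∀ j → suc (suc j) * catalan (suc j) ≡ 2 * (2 * j + 1) * catalan j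
  catalan-suc j = trans (sym (central≡catalan (suc j))) (central-suc≡catalan j)

-- The three-term recurrence for the numerators, by creative telescoping.

module Recurrence where
  open import Data.Nat.Base
  open import Data.Nat.Properties
  open import Data.Nat.Tactic.RingSolver using (solve-∀)
  open import Relation.Binary.PropositionalEquality
  open Binomials
  open ≡-Reasoning

  ∑< : ℕ → (ℕ → ℕ) → ℕ
  ∑< zero    f = 0
  ∑< (suc n) f = ∑< n f + f n

  ∑<-linear : ∀ n a b f g → ∑< n (λ l → a * f l + b * g l) ≡ a * ∑< n f + b * ∑< n g
  ∑<-linear zero    a b f g = sym (cong₂ _+_ (*-zeroʳ a) (*-zeroʳ b))
  ∑<-linear (suc n) a b f g = trans
    (cong (_+ (a * f n + b * g n)) (∑<-linear n a b f g))
    (collect a b (∑< n f) (∑< n g) (f n) (g n))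
    where
    collect : ∀ a b s t x y → a * s + b * t + (a * x + b * y) ≡ a * (s + x) + b * (t + y)
    collect = solve-∀

  -- With q = m - i and l = k - i this is the term of index k of 4ᵐ d i m.
  summand : ℕ → ℕ → ℕ → ℕ
  summand i q l = 2 ^ (l + i) * central (q ∸ l) * binomial (q + i) (l + i) * binomial l i

  numerator : ℕ → ℕ → ℕ
  numerator i q = ∑< (suc q) (summand i q)

  -- The coefficients of the three-term recurrence in n = q + i found by Zeilberger's algorithm, and the
  -- polynomial part of its certificate: Q and Q⁻ are the same polynomial, seen from two consecutive terms.
  K A₀ A₁ A₂ : ℕ → ℕ → ℕ
  K  i q = 4 * i * i + 16 * i * q + 8 * q * q + 24 * (q + i) + 19
  A₀ i q = 4 * (q + i + i + 1) * (4 * (q + i) + 3) * (4 * (q + i) + 5)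
  A₁ i q = 2 * suc (q + i) * K i q
  A₂ i q = (2 + q) * (suc (q + i) * (2 + (q + i)))

  Q : ℕ → ℕ → ℕ → ℕ
  Q i k j = 2 * j * j * j + (2 * k + 2 * i + 4) * j * j + (4 * i * k + 2 * k + 6 * i + 2) * j
    + (2 * k * k + 4 * i * k + 3 * k + 4 * i + 1)

  Q⁻ : ℕ → ℕ → ℕ → ℕ
  Q⁻ i k j = 2 * j * j * j + (2 * k + 2 * i + 8) * j * j + (4 * i * k + 6 * k + 6 * i + 10) * j
    + (2 * k * k + 8 * i * k + 3 * k + 4 * i + 4)

  Q⁻-suc : ∀ i k j → Q⁻ i (suc k) j ≡ Q i k (suc j)
  Q⁻-suc = expanded
    where
    expanded : ∀ i k j →
      2 * j * j * j + (2 * suc k + 2 * i + 8) * j * j + (4 * i * suc k + 6 * suc k + 6 * i + 10) * j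
        + (2 * suc k * suc k + 8 * i * suc k + 3 * suc k + 4 * i + 4)
      ≡ 2 * suc j * suc j * suc j + (2 * k + 2 * i + 4) * suc j * suc j
        + (4 * i * k + 2 * k + 6 * i + 2) * suc j + (2 * k * k + 4 * i * k + 3 * k + 4 * i + 1)
    expanded = solve-∀

  -- The polynomial core of the telescoping: what remains of `telescoping-step` once all binomials
  -- are expressed through one of them and the ratio `2 * (2 * j + 1) : 2 + j` of consecutive
  -- Catalan numbers is inserted.
  certificate-identity : ∀ i l j →
    let q = j + l ; k = l + i ; r = suc (q + i + k) in
    ((2 + q) * (2 * (2 * suc j + 1)) * (r * suc r) + 4 * l * Q⁻ i k j) * (2 * (2 * j + 1))
      + A₀ i q * suc j * (2 + j)
    ≡ 2 * K i q * (2 + j) * r * (2 * (2 * j + 1)) + 8 * Q i k j * r * (2 + j)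
  certificate-identity = expanded
    where
    expanded : ∀ i l j →
      let q = j + l ; k = l + i ; m = q + i ; r = suc (m + k) in
      ((2 + q) * (2 * (2 * suc j + 1)) * (r * suc r)
        + 4 * l * (2 * j * j * j + (2 * k + 2 * i + 8) * j * j + (4 * i * k + 6 * k + 6 * i + 10) * j
          + (2 * k * k + 8 * i * k + 3 * k + 4 * i + 4))) * (2 * (2 * j + 1))
        + 4 * (m + i + 1) * (4 * m + 3) * (4 * m + 5) * suc j * (2 + j)
      ≡ 2 * (4 * i * i + 16 * i * q + 8 * q * q + 24 * m + 19) * (2 + j) * r * (2 * (2 * j + 1))
        + 8 * (2 * j * j * j + (2 * k + 2 * i + 4) * j * j + (4 * i * k + 2 * k + 6 * i + 2) * j
          + (2 * k * k + 4 * i * k + 3 * k + 4 * i + 1)) * r * (2 + j)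
    expanded = solve-∀

  -- The hypothesis says that `κ′` and `κ` are in the ratio `b : a`, so a linear relation between
  -- them can be tested on `b` and `a` themselves.
  eliminate : ∀ a b .{{_ : NonZero a}} X Y Z W {κ κ′} → a * κ′ ≡ b * κ →
    X * b + Y * a ≡ Z * b + W * a → X * κ′ + Y * κ ≡ Z * κ′ + W * κ
  eliminate a b X Y Z W {κ} {κ′} aκ′≡bκ eq = *-cancelˡ-≡ _ _ a (begin
    a * (X * κ′ + Y * κ)  ≡⟨ clear X Y ⟩
    (X * b + Y * a) * κ   ≡⟨ cong (_* κ) eq ⟩
    (Z * b + W * a) * κ   ≡⟨ clear Z W ⟨
    a * (Z * κ′ + W * κ)  ∎)
    where
    expand : ∀ a X Y κ κ′ → a * (X * κ′ + Y * κ) ≡ X * (a * κ′) + Y * a * κ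
    expand = solve-∀
    factor : ∀ a b X Y κ → X * (b * κ) + Y * a * κ ≡ (X * b + Y * a) * κ
    factor = solve-∀
    clear : ∀ X Y → a * (X * κ′ + Y * κ) ≡ (X * b + Y * a) * κ
    clear X Y = trans (expand a X Y κ κ′)
      (trans (cong (λ z → X * z + Y * a * κ) aκ′≡bκ) (factor a b X Y κ))

  -- Here `π` stands for the power of 2, `κ` and `κ′` for consecutive Catalan numbers, `β`, `β′`,
  -- `β″` for the binomials at m, m + 1, m + 2, and `γ` for `binomial l i`. The factors m + 1 and m
  -- + 2 inside `A₁` and `A₂` are just what reduces `β′` and `β″` to `β`; then `π * β * γ` splits
  -- off.
  telescoping-step : ∀ i l j π κ κ′ β β′ β″ γ →
    let q = j + l ; k = l + i ; m = q + i ; r = suc (m + k) in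
    suc m * β′ ≡ r * β → (2 + m) * β″ ≡ suc r * β′ → (2 + j) * κ′ ≡ 2 * (2 * j + 1) * κ →
    A₂ i q * (π * (2 * (2 * suc j + 1) * κ′) * β″ * γ) + A₀ i q * (π * (suc j * κ) * β * γ)
      + 4 * l * Q⁻ i k j * (π * κ′ * β * γ)
    ≡ A₁ i q * (π * ((2 + j) * κ′) * β′ * γ) + 8 * Q i k j * r * (π * κ * β * γ)
  telescoping-step i l j π κ κ′ β β′ β″ γ hβ′ hβ″ hκ = begin
    A₂ i q * (π * (c * κ′) * β″ * γ) + A₀ i q * (π * (suc j * κ) * β * γ) + y * (π * κ′ * β * γ)
      ≡⟨ cong (λ z → z + A₀ i q * (π * (suc j * κ) * β * γ) + y * (π * κ′ * β * γ)) lead ⟩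
    x * κ′ * T + A₀ i q * (π * (suc j * κ) * β * γ) + y * (π * κ′ * β * γ)
      ≡⟨ collectˡ x (A₀ i q) y (suc j) π β γ κ κ′ ⟩
    ((x + y) * κ′ + A₀ i q * suc j * κ) * T
      ≡⟨ cong (_* T) (eliminate (2 + j) (2 * (2 * j + 1)) (x + y) (A₀ i q * suc j)
           (2 * K i q * (2 + j) * r) (8 * Q i k j * r) hκ (certificate-identity i l j)) ⟩
    (2 * K i q * (2 + j) * r * κ′ + 8 * Q i k j * r * κ) * T
      ≡⟨ collectʳ (K i q) (2 + j) r (8 * Q i k j) π β γ κ κ′ ⟩
    2 * K i q * (2 + j) * (r * β) * (π * κ′ * γ) + b
      ≡⟨ cong (λ z → 2 * K i q * (2 + j) * z * (π * κ′ * γ) + b) hβ′ ⟨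
    2 * K i q * (2 + j) * (suc m * β′) * (π * κ′ * γ) + b
      ≡⟨ cong (_+ b) (rearrange (K i q) (2 + j) (suc m) β′ π κ′ γ) ⟩
    A₁ i q * (π * ((2 + j) * κ′) * β′ * γ) + b ∎
    where
    q = j + l
    k = l + i
    m = q + i
    r = suc (m + k)
    T = π * β * γ
    c = 2 * (2 * suc j + 1)
    x = (2 + q) * c * (r * suc r)
    y = 4 * l * Q⁻ i k j
    b = 8 * Q i k j * r * (π * κ * β * γ)
    pull₁ : ∀ s m₁ m₂ c π β″ γ κ′ → s * (m₁ * m₂) * (π * (c * κ′) * β″ * γ) ≡ s * c * (m₁ * (m₂ * β″)) * κ′ * (π * γ)
    pull₁ = solve-∀
    pull₂ : ∀ s c m₁ r₁ β′ κ′ x → s * c * (m₁ * (r₁ * β′)) * κ′ * x ≡ s * c * ((m₁ * β′) * r₁) * κ′ * x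
    pull₂ = solve-∀
    pull₃ : ∀ s c r r₁ β κ′ π γ → s * c * ((r * β) * r₁) * κ′ * (π * γ) ≡ s * c * (r * r₁) * κ′ * (π * β * γ)
    pull₃ = solve-∀
    lead : A₂ i q * (π * (c * κ′) * β″ * γ) ≡ x * κ′ * T
    lead = begin
      A₂ i q * (π * (c * κ′) * β″ * γ)                           ≡⟨ pull₁ (2 + q) (suc m) (2 + m) c π β″ γ κ′ ⟩
      (2 + q) * c * (suc m * ((2 + m) * β″)) * κ′ * (π * γ)      ≡⟨ cong (λ z → (2 + q) * c * (suc m * z) * κ′ * (π * γ)) hβ″ ⟩
      (2 + q) * c * (suc m * (suc r * β′)) * κ′ * (π * γ)        ≡⟨ pull₂ (2 + q) c (suc m) (suc r) β′ κ′ (π * γ) ⟩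
      (2 + q) * c * (suc m * β′ * suc r) * κ′ * (π * γ)          ≡⟨ cong (λ z → (2 + q) * c * (z * suc r) * κ′ * (π * γ)) hβ′ ⟩
      (2 + q) * c * (r * β * suc r) * κ′ * (π * γ)               ≡⟨ pull₃ (2 + q) c r (suc r) β κ′ π γ ⟩
      x * κ′ * T                                                 ∎
    collectˡ : ∀ x a y j₁ π β γ κ κ′ → x * κ′ * (π * β * γ) + a * (π * (j₁ * κ) * β * γ) + y * (π * κ′ * β * γ)
      ≡ ((x + y) * κ′ + a * j₁ * κ) * (π * β * γ)
    collectˡ = solve-∀
    collectʳ : ∀ x j₂ r y π β γ κ κ′ → (2 * x * j₂ * r * κ′ + y * r * κ) * (π * β * γ)
      ≡ 2 * x * j₂ * (r * β) * (π * κ′ * γ) + y * r * (π * κ * β * γ)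
    collectʳ = solve-∀
    rearrange : ∀ x j₂ m₁ β′ π κ′ γ → 2 * x * j₂ * (m₁ * β′) * (π * κ′ * γ) ≡ 2 * m₁ * x * (π * (j₂ * κ′) * β′ * γ)
    rearrange = solve-∀

  summand-at : ∀ i l e → summand i (e + l) l ≡ 2 ^ (l + i) * central e * binomial (e + l + i) (l + i) * binomial l i
  summand-at i l e = cong (λ z → 2 ^ (l + i) * central z * binomial (e + l + i) (l + i) * binomial l i) (m+n∸n≡m e l)

  -- The Zeilberger certificate: the sum over the indices 0 to `l` of the recurrence applied to the
  -- summands. The argument `j` stands for q - l and is passed separately to avoid truncated
  -- subtraction.
  partial-sum : ℕ → ℕ → ℕ → ℕ → ℕ
  partial-sum i q l j = 8 * Q i (l + i) j * suc (q + i + (l + i))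
    * (2 ^ (l + i) * catalan j * binomial (q + i) (l + i) * binomial l i)

  -- The third term on the left is the partial sum up to l - 1, in the form that carries a factor
  -- `l`. Hence this is the increment of the certificate, with negative terms moved across.
  summand-step : ∀ i l j → let q = j + l in
    A₂ i q * summand i (2 + q) l + A₀ i q * summand i q l
      + 4 * l * Q⁻ i (l + i) j * (2 ^ (l + i) * catalan (suc j) * binomial (q + i) (l + i) * binomial l i)
    ≡ A₁ i q * summand i (1 + q) l + partial-sum i q l j
  summand-step i l j = begin
    A₂ i q * summand i (2 + q) l + A₀ i q * summand i q l + y
      ≡⟨ cong₂ (λ u v → A₂ i q * u + A₀ i q * v + y)
           (with-central (2 + j) (central-suc≡catalan (suc j)))
           (with-central j (central≡catalan j)) ⟩
    A₂ i q * (π * (2 * (2 * suc j + 1) * catalan (suc j)) * binomial (2 + q + i) k * γ)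
      + A₀ i q * (π * (suc j * catalan j) * binomial (q + i) k * γ) + y
      ≡⟨ telescoping-step i l j π (catalan j) (catalan (suc j)) (binomial (q + i) k) (binomial (1 + q + i) k) (binomial (2 + q + i) k) γ
           (binomial-sucˡ (q + i) k) (binomial-sucˡ (suc q + i) k) (catalan-suc j) ⟩
    A₁ i q * (π * ((2 + j) * catalan (suc j)) * binomial (1 + q + i) k * γ) + partial-sum i q l j
      ≡⟨ cong (λ u → A₁ i q * u + partial-sum i q l j) (with-central (1 + j) (central≡catalan (suc j))) ⟨
    A₁ i q * summand i (1 + q) l + partial-sum i q l j ∎
    where
    q = j + l
    k = l + i
    π = 2 ^ k
    γ = binomial l i
    y = 4 * l * Q⁻ i k j * (π * catalan (suc j) * binomial (q + i) k * γ)
    with-central : ∀ e {c} → central e ≡ c → summand i (e + l) l ≡ π * c * binomial (e + l + i) k * γ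
    with-central e refl = summand-at i l e

  -- Passing from `l` to `suc l` at fixed q lowers `j` by one. The ratios of both binomials in this
  -- direction convert one form of the certificate into the other, and the extra power of 2 turns 4
  -- into 8.
  partial-sum-suc : ∀ i q l j → partial-sum i q l (suc j) ≡
    4 * suc l * Q⁻ i (suc l + i) j * (2 ^ (suc l + i) * catalan (suc j) * binomial (q + i) (suc l + i) * binomial (suc l) i)
  partial-sum-suc i q l j = sym (begin
    4 * suc l * Q⁻ i (suc k) j * (2 * π * κ * binomial m (suc k) * binomial (suc l) i)
      ≡⟨ pull (suc l) (Q⁻ i (suc k) j) π κ (binomial m (suc k)) (binomial (suc l) i) ⟩
    8 * Q⁻ i (suc k) j * π * κ * binomial m (suc k) * (suc l * binomial (suc l) i)
      ≡⟨ cong₂ (λ u v → 8 * u * π * κ * binomial m (suc k) * v) (Q⁻-suc i k j) (binomial-sucˡ l i) ⟩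
    8 * Q i k (suc j) * π * κ * binomial m (suc k) * (suc k * γ)
      ≡⟨ swap (8 * Q i k (suc j) * π * κ) (binomial m (suc k)) (suc k) γ ⟩
    8 * Q i k (suc j) * π * κ * (suc k * binomial m (suc k)) * γ
      ≡⟨ cong (λ u → 8 * Q i k (suc j) * π * κ * u * γ) (binomial-sucʳ m k) ⟩
    8 * Q i k (suc j) * π * κ * (suc (m + k) * binomial m k) * γ
      ≡⟨ push (8 * Q i k (suc j)) π κ (suc (m + k)) (binomial m k) γ ⟩
    8 * Q i k (suc j) * suc (m + k) * (π * κ * binomial m k * γ) ∎)
    where
    k = l + i
    m = q + i
    π = 2 ^ k
    κ = catalan (suc j)
    γ = binomial l i
    pull : ∀ l₁ z π κ β γ → 4 * l₁ * z * (2 * π * κ * β * γ) ≡ 8 * z * π * κ * β * (l₁ * γ)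
    pull = solve-∀
    swap : ∀ a β k₁ γ → a * β * (k₁ * γ) ≡ a * (k₁ * β) * γ
    swap = solve-∀
    push : ∀ a π κ r β γ → a * π * κ * (r * β) * γ ≡ a * r * (π * κ * β * γ)
    push = solve-∀

  telescope : ∀ i l j q → q ≡ j + l →
    ∑< (suc l) (λ x → A₂ i q * summand i (2 + q) x + A₀ i q * summand i q x)
    ≡ A₁ i q * ∑< (suc l) (summand i (1 + q)) + partial-sum i q l j
  telescope i zero j q refl = begin
    0 + t               ≡⟨ +-identityʳ t ⟨
    -- The `0` is the third term of `summand-step`, which vanishes through its factor `l`.
    t + 0               ≡⟨ summand-step i 0 j ⟩
    A₁ i q * summand i (1 + q) 0 + partial-sum i q 0 j ∎
    where t = A₂ i q * summand i (2 + q) 0 + A₀ i q * summand i q 0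
  telescope i (suc l) j q refl = begin
    ∑< (suc l) f + t                                             ≡⟨ cong (_+ t) (telescope i l (suc j) q (+-suc j l)) ⟩
    A₁ i q * s + partial-sum i q l (suc j) + t                   ≡⟨ cong (λ z → A₁ i q * s + z + t) (partial-sum-suc i q l j) ⟩
    A₁ i q * s + y + t                                           ≡⟨ +-assoc (A₁ i q * s) y t ⟩
    A₁ i q * s + (y + t)                                         ≡⟨ cong (A₁ i q * s +_) (trans (+-comm y t) (summand-step i (suc l) j)) ⟩
    A₁ i q * s + (A₁ i q * u + partial-sum i q (suc l) j)        ≡⟨ collect (A₁ i q) s u _ ⟩
    A₁ i q * (s + u) + partial-sum i q (suc l) j                 ∎
    where
    f = λ x → A₂ i q * summand i (2 + q) x + A₀ i q * summand i q x
    t = f (suc l)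
    s = ∑< (suc l) (summand i (1 + q))
    u = summand i (1 + q) (suc l)
    y = 4 * suc l * Q⁻ i (suc l + i) j * (2 ^ (suc l + i) * catalan (suc j) * binomial (q + i) (suc l + i) * binomial (suc l) i)
    collect : ∀ a s u p → a * s + (a * u + p) ≡ a * (s + u) + p
    collect = solve-∀

  -- Telescoping covers the indices up to q only. The numerator at q + 1 has one further term and
  -- the one at q + 2 has two; these boundary terms account for the last partial sum.
  closing-identity : ∀ i q π β₀ β₁ β₂ β₃ γ₀ γ₁ γ₂ → let m = q + i in
    suc m * β₁ ≡ 2 * (2 * m + 1) * β₀ → (2 + m) * β₂ ≡ suc (suc m + suc m) * β₁ →
    (2 + m) * β₃ ≡ 2 * (2 * suc m + 1) * β₁ →
    suc q * γ₁ ≡ suc m * γ₀ → (2 + q) * γ₂ ≡ (2 + m) * γ₁ →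
    8 * Q i m 0 * suc (m + m) * (π * 1 * β₀ * γ₀) + A₂ i q * (2 * π * 2 * β₂ * γ₁ + 2 * (2 * π) * 1 * β₃ * γ₂)
    ≡ A₁ i q * (2 * π * 1 * β₁ * γ₁)
  closing-identity i q π β₀ β₁ β₂ β₃ γ₀ γ₁ γ₂ hβ₁ hβ₂ hβ₃ hγ₁ hγ₂ = begin
    8 * Q i m 0 * suc (m + m) * (π * 1 * β₀ * γ₀) + A₂ i q * (2 * π * 2 * β₂ * γ₁ + 2 * (2 * π) * 1 * β₃ * γ₂)
      ≡⟨ cong₂ _+_ (regroup₁ i m π β₀ γ₀) (regroup₂ (2 + q) (suc m) (2 + m) π β₂ β₃ γ₁ γ₂) ⟩
    4 * (2 * m + 4 * i + 1) * π * (2 * (2 * m + 1) * β₀) * (suc m * γ₀)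
      + 4 * suc m * π * ((2 + q) * γ₁ * ((2 + m) * β₂) + (2 + m) * β₃ * ((2 + q) * γ₂))
      ≡⟨ cong₂ (λ u v → 4 * (2 * m + 4 * i + 1) * π * u * v
             + 4 * suc m * π * ((2 + q) * γ₁ * ((2 + m) * β₂) + (2 + m) * β₃ * ((2 + q) * γ₂))) hβ₁ hγ₁ ⟨
    4 * (2 * m + 4 * i + 1) * π * (suc m * β₁) * (suc q * γ₁)
      + 4 * suc m * π * ((2 + q) * γ₁ * ((2 + m) * β₂) + (2 + m) * β₃ * ((2 + q) * γ₂))
      ≡⟨ cong (λ u → 4 * (2 * m + 4 * i + 1) * π * (suc m * β₁) * (suc q * γ₁) + 4 * suc m * π * u)
           (cong₂ _+_ (cong ((2 + q) * γ₁ *_) hβ₂) (cong₂ _*_ hβ₃ hγ₂)) ⟩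
    4 * (2 * m + 4 * i + 1) * π * (suc m * β₁) * (suc q * γ₁)
      + 4 * suc m * π * ((2 + q) * γ₁ * (suc (suc m + suc m) * β₁) + 2 * (2 * suc m + 1) * β₁ * ((2 + m) * γ₁))
      ≡⟨ total i q π β₁ γ₁ ⟩
    A₁ i q * (2 * π * 1 * β₁ * γ₁) ∎
    where
    m = q + i
    regroup₁ : ∀ i m π β γ →
      8 * (0 + (2 * m + 2 * i + 4) * 0 * 0 + (4 * i * m + 2 * m + 6 * i + 2) * 0 + (2 * m * m + 4 * i * m + 3 * m + 4 * i + 1))
        * suc (m + m) * (π * 1 * β * γ)
      ≡ 4 * (2 * m + 4 * i + 1) * π * (2 * (2 * m + 1) * β) * (suc m * γ)
    regroup₁ = solve-∀
    regroup₂ : ∀ q₂ m₁ m₂ π β₂ β₃ γ₁ γ₂ → q₂ * (m₁ * m₂) * (2 * π * 2 * β₂ * γ₁ + 2 * (2 * π) * 1 * β₃ * γ₂)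
      ≡ 4 * m₁ * π * (q₂ * γ₁ * (m₂ * β₂) + m₂ * β₃ * (q₂ * γ₂))
    regroup₂ = solve-∀
    total : ∀ i q π β₁ γ₁ → let m = q + i in
      4 * (2 * m + 4 * i + 1) * π * (suc m * β₁) * (suc q * γ₁)
        + 4 * suc m * π * ((2 + q) * γ₁ * (suc (suc m + suc m) * β₁) + 2 * (2 * suc m + 1) * β₁ * ((2 + m) * γ₁))
      ≡ 2 * suc m * (4 * i * i + 16 * i * q + 8 * q * q + 24 * m + 19) * (2 * π * 1 * β₁ * γ₁)
    total = solve-∀

  summand-diagonal : ∀ i l → summand i l l ≡ 2 ^ (l + i) * 1 * central (l + i) * binomial l i
  summand-diagonal i l = trans (summand-at i l 0) (cong (λ c → 2 ^ (l + i) * c * central (l + i) * binomial l i) (binomial-0 0))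

  numerator-recurrence : ∀ i q →
    A₂ i q * numerator i (2 + q) + A₀ i q * numerator i q ≡ A₁ i q * numerator i (1 + q)
  numerator-recurrence i q = begin
    A₂ i q * (s₂ + u + v) + A₀ i q * s₀               ≡⟨ split (A₂ i q) (A₀ i q) s₂ s₀ u v ⟩
    A₂ i q * s₂ + A₀ i q * s₀ + A₂ i q * (u + v)      ≡⟨ cong (_+ A₂ i q * (u + v)) (∑<-linear (suc q) (A₂ i q) (A₀ i q) (summand i (2 + q)) (summand i q)) ⟨
    ∑< (suc q) (λ x → A₂ i q * summand i (2 + q) x + A₀ i q * summand i q x) + A₂ i q * (u + v)
                                                      ≡⟨ cong (_+ A₂ i q * (u + v)) (telescope i q 0 q refl) ⟩
    A₁ i q * s₁ + partial-sum i q q 0 + A₂ i q * (u + v)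
                                                      ≡⟨ +-assoc (A₁ i q * s₁) (partial-sum i q q 0) (A₂ i q * (u + v)) ⟩
    A₁ i q * s₁ + (partial-sum i q q 0 + A₂ i q * (u + v))
                                                      ≡⟨ cong (A₁ i q * s₁ +_) closing ⟩
    A₁ i q * s₁ + A₁ i q * w                          ≡⟨ *-distribˡ-+ (A₁ i q) s₁ w ⟨
    A₁ i q * (s₁ + w)                                 ∎
    where
    m = q + i
    s₀ = ∑< (suc q) (summand i q)
    s₁ = ∑< (suc q) (summand i (1 + q))
    s₂ = ∑< (suc q) (summand i (2 + q))
    u = summand i (2 + q) (1 + q)
    v = summand i (2 + q) (2 + q)
    w = summand i (1 + q) (1 + q)
    split : ∀ a b s t u v → a * (s + u + v) + b * t ≡ a * s + b * t + a * (u + v)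
    split = solve-∀
    u≡ : u ≡ 2 ^ (suc m) * 2 * binomial (2 + m) (suc m) * binomial (suc q) i
    u≡ = trans (summand-at i (suc q) 1)
      (cong (λ c → 2 ^ (suc m) * c * binomial (2 + m) (suc m) * binomial (suc q) i) (central-suc≡catalan 0))
    closing : partial-sum i q q 0 + A₂ i q * (u + v) ≡ A₁ i q * w
    closing = begin
      partial-sum i q q 0 + A₂ i q * (u + v)
        ≡⟨ cong₂ (λ x y → partial-sum i q q 0 + A₂ i q * (x + y)) u≡ (summand-diagonal i (2 + q)) ⟩
      partial-sum i q q 0 + A₂ i q * (2 ^ (suc m) * 2 * binomial (2 + m) (suc m) * binomial (suc q) i
        + 2 ^ (2 + m) * 1 * central (2 + m) * binomial (2 + q) i)
        ≡⟨ closing-identity i q (2 ^ m) (central m) (central (suc m)) (binomial (2 + m) (suc m)) (central (2 + m))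
             (binomial q i) (binomial (suc q) i) (binomial (2 + q) i)
             (central-suc m) (binomial-sucˡ (suc m) (suc m)) (central-suc (suc m)) (binomial-sucˡ q i) (binomial-sucˡ (suc q) i) ⟩
      A₁ i q * (2 ^ (suc m) * 1 * central (suc m) * binomial (suc q) i)
        ≡⟨ cong (A₁ i q *_) (summand-diagonal i (suc q)) ⟨
      A₁ i q * w ∎

  -- A recurrence of order two leaves the ratio of the first two values to be computed directly,
  -- here from sums of one and two terms.
  numerator-initial : ∀ i → suc i * numerator i 1 ≡ 2 * (2 * i + 1) * (2 * i + 3) * numerator i 0
  numerator-initial i = begin
    suc i * (summand i 1 0 + summand i 1 1)
      ≡⟨ cong₂ (λ x y → suc i * (x + y)) first (summand-diagonal i 1) ⟩
    suc i * (π * 2 * binomial (suc i) i * binomial 0 i + 2 * π * 1 * central (suc i) * binomial 1 i)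
      ≡⟨ cong₂ (λ x y → suc i * (π * 2 * binomial (suc i) i * x + 2 * π * 1 * central (suc i) * y)) (binomial-0 i) second ⟩
    suc i * (π * 2 * binomial (suc i) i * 1 + 2 * π * 1 * central (suc i) * suc i)
      ≡⟨ regroup i π (binomial (suc i) i) (central (suc i)) ⟩
    2 * π * (suc i * binomial (suc i) i) + 2 * π * suc i * (suc i * central (suc i))
      ≡⟨ cong₂ (λ x y → 2 * π * x + 2 * π * suc i * y) (binomial-sucˡ i i) (central-suc i) ⟩
    2 * π * (suc (i + i) * central i) + 2 * π * suc i * (2 * (2 * i + 1) * central i)
      ≡⟨ total i π (central i) ⟩
    2 * (2 * i + 1) * (2 * i + 3) * (π * 1 * central i * 1)
      ≡⟨ cong (λ x → 2 * (2 * i + 1) * (2 * i + 3) * (π * 1 * central i * x)) (binomial-0 i) ⟨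
    2 * (2 * i + 1) * (2 * i + 3) * (π * 1 * central i * binomial 0 i)
      ≡⟨ cong (2 * (2 * i + 1) * (2 * i + 3) *_) (summand-diagonal i 0) ⟨
    2 * (2 * i + 1) * (2 * i + 3) * numerator i 0 ∎
    where
    π = 2 ^ i
    first : summand i 1 0 ≡ π * 2 * binomial (suc i) i * binomial 0 i
    first = trans (summand-at i 0 1) (cong (λ c → π * c * binomial (suc i) i * binomial 0 i) (central-suc≡catalan 0))
    second : binomial 1 i ≡ suc i
    second = trans (sym (*-identityˡ (binomial 1 i))) (trans (binomial-sucˡ 0 i) (trans (cong (suc i *_) (binomial-0 i)) (*-identityʳ (suc i))))
    regroup : ∀ i π b c → suc i * (π * 2 * b * 1 + 2 * π * 1 * c * suc i) ≡ 2 * π * (suc i * b) + 2 * π * suc i * (suc i * c)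
    regroup = solve-∀
    total : ∀ i π c → 2 * π * (suc (i + i) * c) + 2 * π * suc i * (2 * (2 * i + 1) * c) ≡ 2 * (2 * i + 1) * (2 * i + 3) * (π * 1 * c * 1)
    total = solve-∀

  -- The last term of the sum is already positive.
  numerator≢0 : ∀ i q → NonZero (numerator i q)
  numerator≢0 i q = >-nonZero (<-≤-trans (>-nonZero⁻¹ (summand i q q)) (m≤n+m (summand i q q) (∑< q (summand i q))))
    where
    instance
      _ = m^n≢0 2 (q + i)
      _ = binomial≢0 (q + i) (q + i)
      _ = binomial≢0 q i
      _ = m*n≢0 (2 ^ (q + i)) 1
      _ = m*n≢0 (2 ^ (q + i) * 1) (central (q + i))
      _ = subst NonZero (sym (summand-diagonal i q)) (m*n≢0 (2 ^ (q + i) * 1 * central (q + i)) (binomial q i))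

-- The quartic form in N and h, and its sign.

module QuarticForm where
  open import Data.Fin.Patterns using (0F; 1F; 2F; 3F)
  open import Data.Nat.Base
  open import Data.Vec.Base using ([]; _∷_)
  open CoefficientwiseComparison

  -- The formulas below are used both for numbers and, as expressions, as input of coefficientwise-≤.
  record Arithmetic (A : Set) : Set where
    infixl 6 _⊕_
    infixl 7 _⊗_
    field
      lit     : ℕ → A
      _⊕_ _⊗_ : A → A → A

  ℕ-arithmetic : Arithmetic ℕ
  ℕ-arithmetic = record { lit = λ c → c ; _⊕_ = _+_ ; _⊗_ = _*_ }

  Expr-arithmetic : ∀ n → Arithmetic (Expr n)
  Expr-arithmetic n = record { lit = con ; _⊕_ = _:+_ ; _⊗_ = _:*_ }

  module Formulas {A : Set} (R : Arithmetic A) where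
    open Arithmetic R

    -- In all formulas n = q + i. The numerators N of d i n and N′ of d i (n + 1), over the denominators 4ⁿ and 4ⁿ⁺¹,
    -- satisfy (q + 1) N′ = 2 s N + h with an excess h ≥ 0, whose successor h′ is given by
    -- (q + 1) c h′ = 2 β h + 4 s i² N.
    s c β M : A → A → A
    s i q = lit 4 ⊗ (q ⊕ i) ⊕ lit 3
    c i q = (lit 1 ⊕ (q ⊕ i)) ⊗ (lit 2 ⊕ (q ⊕ i))
    β i q = (lit 1 ⊕ (q ⊕ i)) ⊗ (lit 8 ⊗ i ⊗ q ⊕ lit 4 ⊗ q ⊗ q ⊕ lit 9 ⊗ (q ⊕ i) ⊕ lit 5)
    M i q = i ⊗ i ⊕ (q ⊕ i)

    next-N next-h : (i q N h : A) → A
    next-N i q N h = lit 2 ⊗ s i q ⊗ N ⊕ h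
    next-h i q N h = lit 2 ⊗ β i q ⊗ h ⊕ lit 4 ⊗ s i q ⊗ i ⊗ i ⊗ N

    -- Up to the common factor S of the module Scaling, lower and upper are the two sides of the inequality
    -- for N, N′, N″, N‴, expressed through N and h alone.
    module _ (i q N h : A) where
      q₁ q₂ q₃ a₁ b₁ a₂ b₂ a₃ lower upper : A
      q₁ = lit 1 ⊕ q
      q₂ = lit 2 ⊕ q
      q₃ = lit 3 ⊕ q
      a₁ = next-N i q N h
      b₁ = next-h i q N h
      a₂ = next-N i q₁ (c i q ⊗ a₁) b₁
      b₂ = next-h i q₁ (c i q ⊗ a₁) b₁
      a₃ = next-N i q₂ (c i q₁ ⊗ a₂) b₂
      lower = q₁ ⊗ q₂ ⊗ q₃ ⊗ c i q ⊗ c i q₁ ⊗ (a₁ ⊗ a₁ ⊗ (N ⊗ a₂)) ⊕ q₁ ⊗ q₁ ⊗ q₃ ⊗ c i q₁ ⊗ (N ⊗ N ⊗ (a₂ ⊗ a₂))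
      upper = q₂ ⊗ q₂ ⊗ q₃ ⊗ c i q ⊗ c i q ⊗ c i q₁ ⊗ (a₁ ⊗ a₁ ⊗ (a₁ ⊗ a₁)) ⊕ q₁ ⊗ q₁ ⊗ q₂ ⊗ c i q ⊗ (N ⊗ N ⊗ (a₁ ⊗ a₃))

  open Formulas ℕ-arithmetic public

  private module E = Formulas (Expr-arithmetic 4)

  -- Since h is known through `M i q * h`, both arguments are multiplied by `M i q`, which keeps the
  -- substitution polynomial. The shift `i = suc j` encodes i ≥ 1, and the additional N⁴ provides
  -- strictness.
  quartic-positive : ∀ j q N e → let i = suc j in
    N * N * (N * N) + lower i q (M i q * N) (2 * i * i * N + e) ≤ upper i q (M i q * N) (2 * i * i * N + e)
  quartic-positive j q N e = coefficientwise-≤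
    (n :* n :* (n :* n) :+ E.lower i x (E.M i x :* n) h) (E.upper i x (E.M i x :* n) h) _ (N ∷ e ∷ j ∷ q ∷ [])
    where
    n = var 0F
    i = con 1 :+ var 2F
    x = var 3F
    h = con 2 :* i :* i :* n :+ var 1F

  quartic-negative : ∀ q N → N * N * (N * N) + upper 0 q N 0 ≤ lower 0 q N 0
  quartic-negative q N = coefficientwise-≤
    (n :* n :* (n :* n) :+ E₂.upper (con 0) x n (con 0)) (E₂.lower (con 0) x n (con 0)) _ (N ∷ q ∷ [])
    where
    module E₂ = Formulas (Expr-arithmetic 2)
    n = var 0F
    x = var 1F

  -- The induction step of `excess-lower-bound`, cleared of the denominators `M i q` and
  -- `suc q * c i q`; `e` is the slack of the induction hypothesis.
  invariant-positive : ∀ i q N e →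
    2 * i * i * c i q * next-N i q (M i q * N) (2 * i * i * N + e)
    ≤ M i (suc q) * next-h i q (M i q * N) (2 * i * i * N + e)
  invariant-positive i q N e = coefficientwise-≤
    (con 2 :* y :* y :* E.c y x :* E.next-N y x (E.M y x :* n) h) (E.M y (con 1 :+ x) :* E.next-h y x (E.M y x :* n) h)
    _ (N ∷ e ∷ i ∷ q ∷ [])
    where
    n = var 0F
    y = var 2F
    x = var 3F
    h = con 2 :* y :* y :* n :+ var 1F

-- The excess, its lower bound, and the inequality for numerators.

module NumeratorInequality where
  open import Data.Nat.Base
  open import Data.Nat.Properties
  open import Data.Nat.Tactic.RingSolver using (solve-∀)
  open import Relation.Binary.PropositionalEquality
  open import Algebra.Properties.CommutativeSemigroup *-commutativeSemigroup using (x∙yz≈y∙xz)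
  open Recurrence
  open QuarticForm

  excess : ℕ → ℕ → ℕ
  excess i q = suc q * numerator i (suc q) ∸ 2 * s i q * numerator i q

  -- This is the origin of `next-h`. The coefficient `A₁ i q` exceeds `2 * c i q * s i (suc q)` by
  -- `2 * β i q`, and `4 * β i q * s i q * N` covers `suc q * A₀ i q * N` with
  -- `4 * s i q * i * i * N` to spare.
  recurrence-via-excess : ∀ i q N N′ N″ h →
    A₂ i q * N″ + A₀ i q * N ≡ A₁ i q * N′ → suc q * N′ ≡ next-N i q N h →
    suc q * c i q * ((2 + q) * N″) ≡ suc q * c i q * (2 * s i (suc q) * N′) + next-h i q N h
  recurrence-via-excess i q N N′ N″ h rec N′≡ = +-cancelʳ-≡ (suc q * A₀ i q * N) _ _ (begin
    suc q * c i q * ((2 + q) * N″) + suc q * A₀ i q * N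
      ≡⟨ regroup (suc q) (2 + q) (suc (q + i)) (2 + (q + i)) (A₀ i q) N N″ ⟩
    suc q * (A₂ i q * N″ + A₀ i q * N)
      ≡⟨ cong (suc q *_) rec ⟩
    suc q * (A₁ i q * N′)
      ≡⟨ x∙yz≈y∙xz (suc q) (A₁ i q) N′ ⟩
    A₁ i q * (suc q * N′)
      ≡⟨ cong (A₁ i q *_) N′≡ ⟩
    A₁ i q * next-N i q N h
      ≡⟨ polynomial i q N h ⟩
    c i q * (2 * s i (suc q) * next-N i q N h) + next-h i q N h + suc q * A₀ i q * N
      ≡⟨ cong (λ z → c i q * (2 * s i (suc q) * z) + next-h i q N h + suc q * A₀ i q * N) N′≡ ⟨
    c i q * (2 * s i (suc q) * (suc q * N′)) + next-h i q N h + suc q * A₀ i q * N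
      ≡⟨ cong (λ z → z + next-h i q N h + suc q * A₀ i q * N) (pull (c i q) (2 * s i (suc q)) (suc q) N′) ⟩
    suc q * c i q * (2 * s i (suc q) * N′) + next-h i q N h + suc q * A₀ i q * N ∎)
    where
    open ≡-Reasoning
    regroup : ∀ q₁ q₂ n₁ n₂ a N N″ → q₁ * (n₁ * n₂) * (q₂ * N″) + q₁ * a * N ≡ q₁ * (q₂ * (n₁ * n₂) * N″ + a * N)
    regroup = solve-∀
    pull : ∀ c s q₁ N′ → c * (s * (q₁ * N′)) ≡ q₁ * c * (s * N′)
    pull = solve-∀
    polynomial : ∀ i q N h → let n = q + i in
      2 * suc n * (4 * i * i + 16 * i * q + 8 * q * q + 24 * n + 19) * (2 * (4 * n + 3) * N + h)
      ≡ suc n * (2 + n) * (2 * (4 * suc n + 3) * (2 * (4 * n + 3) * N + h))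
        + (2 * (suc n * (8 * i * q + 4 * q * q + 9 * n + 5)) * h + 4 * (4 * n + 3) * i * i * N)
        + suc q * (4 * (n + i + 1) * (4 * n + 3) * (4 * n + 5)) * N
    polynomial = solve-∀

  -- The truncated difference in `excess` is a genuine one: cleared of `suc q * c i q`, each next
  -- difference equals `next-h`, a natural number.
  numerator-suc : ∀ i q → suc q * numerator i (suc q) ≡ next-N i q (numerator i q) (excess i q)
  numerator-suc i q = sym (m+[n∸m]≡n (bound q))
    where
    bound : ∀ q → 2 * s i q * numerator i q ≤ suc q * numerator i (suc q)
    bound zero = *-cancelˡ-≤ (suc i) (begin
      suc i * (2 * s i 0 * numerator i 0)                        ≤⟨ m≤m+n _ (2 * i * numerator i 0) ⟩
      suc i * (2 * s i 0 * numerator i 0) + 2 * i * numerator i 0 ≡⟨ expand i (numerator i 0) ⟩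
      2 * (2 * i + 1) * (2 * i + 3) * numerator i 0              ≡⟨ numerator-initial i ⟨
      suc i * numerator i 1                                      ≡⟨ cong (suc i *_) (*-identityˡ (numerator i 1)) ⟨
      suc i * (1 * numerator i 1)                                ∎)
      where
      open ≤-Reasoning
      expand : ∀ i N → suc i * (2 * (4 * i + 3) * N) + 2 * i * N ≡ 2 * (2 * i + 1) * (2 * i + 3) * N
      expand = solve-∀
    bound (suc q) = *-cancelˡ-≤ (suc q * c i q) (begin
      suc q * c i q * (2 * s i (suc q) * numerator i (suc q))
        ≤⟨ m≤m+n _ (next-h i q (numerator i q) (excess i q)) ⟩
      suc q * c i q * (2 * s i (suc q) * numerator i (suc q)) + next-h i q (numerator i q) (excess i q)
        ≡⟨ recurrence-via-excess i q (numerator i q) (numerator i (suc q)) (numerator i (2 + q)) (excess i q)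
             (numerator-recurrence i q) (sym (m+[n∸m]≡n (bound q))) ⟨
      suc q * c i q * ((2 + q) * numerator i (2 + q)) ∎)
      where open ≤-Reasoning

  excess-suc : ∀ i q → suc q * c i q * excess i (suc q) ≡ next-h i q (numerator i q) (excess i q)
  excess-suc i q = +-cancelˡ-≡ (suc q * c i q * (2 * s i (suc q) * numerator i (suc q))) _ _ (begin
    suc q * c i q * (2 * s i (suc q) * numerator i (suc q)) + suc q * c i q * excess i (suc q)
      ≡⟨ *-distribˡ-+ (suc q * c i q) (2 * s i (suc q) * numerator i (suc q)) (excess i (suc q)) ⟨
    suc q * c i q * next-N i (suc q) (numerator i (suc q)) (excess i (suc q))
      ≡⟨ cong (suc q * c i q *_) (numerator-suc i (suc q)) ⟨
    suc q * c i q * ((2 + q) * numerator i (2 + q))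
      ≡⟨ recurrence-via-excess i q (numerator i q) (numerator i (suc q)) (numerator i (2 + q)) (excess i q)
           (numerator-recurrence i q) (numerator-suc i q) ⟩
    suc q * c i q * (2 * s i (suc q) * numerator i (suc q)) + next-h i q (numerator i q) (excess i q) ∎)
    where open ≡-Reasoning

  excess-initial : ∀ i → suc i * excess i 0 ≡ 2 * i * numerator i 0
  excess-initial i = +-cancelˡ-≡ (suc i * (2 * s i 0 * numerator i 0)) _ _ (begin
    suc i * (2 * s i 0 * numerator i 0) + suc i * excess i 0     ≡⟨ *-distribˡ-+ (suc i) (2 * s i 0 * numerator i 0) (excess i 0) ⟨
    suc i * next-N i 0 (numerator i 0) (excess i 0)              ≡⟨ cong (suc i *_) (trans (sym (numerator-suc i 0)) (*-identityˡ (numerator i 1))) ⟩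
    suc i * numerator i 1                                        ≡⟨ numerator-initial i ⟩
    2 * (2 * i + 1) * (2 * i + 3) * numerator i 0                ≡⟨ expand i (numerator i 0) ⟩
    suc i * (2 * s i 0 * numerator i 0) + 2 * i * numerator i 0  ∎)
    where
    open ≡-Reasoning
    expand : ∀ i N → 2 * (2 * i + 1) * (2 * i + 3) * N ≡ suc i * (2 * (4 * i + 3) * N) + 2 * i * N
    expand = solve-∀

  next-N-scale : ∀ i q m N h → m * next-N i q N h ≡ next-N i q (m * N) (m * h)
  next-N-scale i q m N h = expanded m (s i q) N h
    where
    expanded : ∀ m s N h → m * (2 * s * N + h) ≡ 2 * s * (m * N) + m * h
    expanded = solve-∀

  next-h-scale : ∀ i q m N h → m * next-h i q N h ≡ next-h i q (m * N) (m * h)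
  next-h-scale i q m N h = expanded m (β i q) (s i q) i N h
    where
    expanded : ∀ m β s i N h → m * (2 * β * h + 4 * s * i * i * N) ≡ 2 * β * (m * h) + 4 * s * i * i * (m * N)
    expanded = solve-∀

  -- h ≥ 0 alone does not suffice: the coefficient of N⁴ in the quartic form is negative when i and q are large.
  excess-lower-bound : ∀ i q → 2 * i * i * numerator i q ≤ M i q * excess i q
  excess-lower-bound i zero = ≤-reflexive (begin
    2 * i * i * numerator i 0    ≡⟨ swap i (numerator i 0) ⟩
    i * (2 * i * numerator i 0)  ≡⟨ cong (i *_) (excess-initial i) ⟨
    i * (suc i * excess i 0)     ≡⟨ expand i (excess i 0) ⟩
    M i 0 * excess i 0           ∎)
    where
    open ≡-Reasoning
    swap : ∀ i N → 2 * i * i * N ≡ i * (2 * i * N)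
    swap = solve-∀
    expand : ∀ i h → i * (suc i * h) ≡ (i * i + i) * h
    expand = solve-∀
  -- Separated because `M 0 0` is zero and could not be cancelled in the next clause.
  excess-lower-bound zero    (suc q) = z≤n
  excess-lower-bound i@(suc _) (suc q) = *-cancelˡ-≤ (M i q * (suc q * c i q)) (begin
    m * (suc q * c i q) * (2 * i * i * N′)          ≡⟨ regroup m (suc q) (c i q) i N′ ⟩
    2 * i * i * c i q * (m * (suc q * N′))          ≡⟨ cong (λ z → 2 * i * i * c i q * (m * z)) (numerator-suc i q) ⟩
    2 * i * i * c i q * (m * next-N i q N h)        ≡⟨ cong (2 * i * i * c i q *_) (trans (next-N-scale i q m N h) (cong (next-N i q (m * N)) mh)) ⟩
    2 * i * i * c i q * next-N i q (m * N) (2 * i * i * N + e)  ≤⟨ invariant-positive i q N e ⟩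
    M i (suc q) * next-h i q (m * N) (2 * i * i * N + e)  ≡⟨ cong (M i (suc q) *_) (trans (next-h-scale i q m N h) (cong (next-h i q (m * N)) mh)) ⟨
    M i (suc q) * (m * next-h i q N h)              ≡⟨ cong (λ z → M i (suc q) * (m * z)) (excess-suc i q) ⟨
    M i (suc q) * (m * (suc q * c i q * h′))        ≡⟨ swap (M i (suc q)) m (suc q * c i q) h′ ⟩
    m * (suc q * c i q) * (M i (suc q) * h′)        ∎)
    where
    open ≤-Reasoning
    m = M i q
    N = numerator i q
    N′ = numerator i (suc q)
    h = excess i q
    h′ = excess i (suc q)
    e = m * h ∸ 2 * i * i * N
    mh : m * h ≡ 2 * i * i * N + e
    mh = sym (m+[n∸m]≡n (excess-lower-bound i q))
    regroup : ∀ m q c i N → m * (q * c) * (2 * i * i * N) ≡ 2 * i * i * c * (m * (q * N))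
    regroup = solve-∀
    swap : ∀ a m x h → a * (m * (x * h)) ≡ m * x * (a * h)
    swap = solve-∀

  -- For i = 0 both the initial excess and the source term with `i * i` vanish, so the numerators
  -- become hypergeometric with ratio `2 * s 0 q : suc q`.
  excess-0 : ∀ q → excess 0 q ≡ 0
  excess-0 zero    = trans (sym (*-identityˡ (excess 0 0))) (excess-initial 0)
  excess-0 (suc q) = *-cancelˡ-≡ (excess 0 (suc q)) 0 (suc q * c 0 q) (begin
    suc q * c 0 q * excess 0 (suc q)      ≡⟨ excess-suc 0 q ⟩
    next-h 0 q (numerator 0 q) (excess 0 q)  ≡⟨ cong (next-h 0 q (numerator 0 q)) (excess-0 q) ⟩
    next-h 0 q (numerator 0 q) 0          ≡⟨ vanish (β 0 q) (s 0 q) (numerator 0 q) ⟩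
    0                                     ≡⟨ *-zeroʳ (suc q * c 0 q) ⟨
    suc q * c 0 q * 0                     ∎)
    where
    open ≡-Reasoning
    vanish : ∀ β s N → 2 * β * 0 + 4 * s * 0 * 0 * N ≡ 0
    vanish = solve-∀

  -- The two sides for consecutive values u, v, w, x, with each subtracted product moved to the
  -- other side so that everything stays in ℕ.
  Left Right : (u v w x : ℕ) → ℕ
  Left  u v w x = v * v * (u * w) + u * u * (w * w)
  Right u v w x = v * v * (v * v) + u * u * (v * x)

  module Scaling (i q u v w x h h′ h″ : ℕ)
    (v≡ : suc q * v ≡ next-N i q u h) (h′≡ : suc q * c i q * h′ ≡ next-h i q u h)
    (w≡ : (2 + q) * w ≡ next-N i (1 + q) v h′) (h″≡ : (2 + q) * c i (1 + q) * h″ ≡ next-h i (1 + q) v h′)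
    (x≡ : (3 + q) * x ≡ next-N i (2 + q) w h″) where
    open ≡-Reasoning

    p₁ p₂ p₃ c₁ c₂ S : ℕ
    p₁ = 1 + q
    p₂ = 2 + q
    p₃ = 3 + q
    c₁ = c i q
    c₂ = c i (1 + q)
    -- The formal denominators of v, w, x are `p₁`, `p₁ * c₁ * p₂` and `p₁ * c₁ * p₂ * c₂ * p₃`; `S`
    -- is the least common multiple of those of the four quartic monomials.
    S  = p₁ * p₁ * p₁ * p₁ * p₂ * p₂ * p₃ * c₁ * c₁ * c₂

    -- `next-N` and `next-h` are homogeneous in both arguments jointly. The factor `c₁` on `a₁`
    -- gives it the same multiplier `p₁ * c₁` that `b₁` carries.
    c₁a₁≡ : c₁ * a₁ i q u h ≡ p₁ * c₁ * v
    c₁a₁≡ = trans (cong (c₁ *_) (sym v≡)) (swap c₁ p₁ v)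
      where
      swap : ∀ a b c → a * (b * c) ≡ b * a * c
      swap = solve-∀

    a₂≡ : a₂ i q u h ≡ p₁ * c₁ * (p₂ * w)
    a₂≡ = begin
      next-N i p₁ (c₁ * a₁ i q u h) (b₁ i q u h)   ≡⟨ cong₂ (next-N i p₁) c₁a₁≡ (sym h′≡) ⟩
      next-N i p₁ (p₁ * c₁ * v) (p₁ * c₁ * h′)     ≡⟨ next-N-scale i p₁ (p₁ * c₁) v h′ ⟨
      p₁ * c₁ * next-N i p₁ v h′                   ≡⟨ cong (p₁ * c₁ *_) w≡ ⟨
      p₁ * c₁ * (p₂ * w)                           ∎

    b₂≡ : b₂ i q u h ≡ p₁ * c₁ * (p₂ * c₂ * h″)
    b₂≡ = begin
      next-h i p₁ (c₁ * a₁ i q u h) (b₁ i q u h)   ≡⟨ cong₂ (next-h i p₁) c₁a₁≡ (sym h′≡) ⟩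
      next-h i p₁ (p₁ * c₁ * v) (p₁ * c₁ * h′)     ≡⟨ next-h-scale i p₁ (p₁ * c₁) v h′ ⟨
      p₁ * c₁ * next-h i p₁ v h′                   ≡⟨ cong (p₁ * c₁ *_) h″≡ ⟨
      p₁ * c₁ * (p₂ * c₂ * h″)                     ∎

    a₃≡ : a₃ i q u h ≡ p₁ * c₁ * (p₂ * c₂) * (p₃ * x)
    a₃≡ = begin
      next-N i p₂ (c₂ * a₂ i q u h) (b₂ i q u h)
        ≡⟨ cong₂ (next-N i p₂) (trans (cong (c₂ *_) a₂≡) (swap c₂ (p₁ * c₁) p₂ w)) (trans b₂≡ (sym (*-assoc (p₁ * c₁) (p₂ * c₂) h″))) ⟩
      next-N i p₂ (p₁ * c₁ * (p₂ * c₂) * w) (p₁ * c₁ * (p₂ * c₂) * h″)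
        ≡⟨ next-N-scale i p₂ (p₁ * c₁ * (p₂ * c₂)) w h″ ⟨
      p₁ * c₁ * (p₂ * c₂) * next-N i p₂ w h″
        ≡⟨ cong (p₁ * c₁ * (p₂ * c₂) *_) x≡ ⟨
      p₁ * c₁ * (p₂ * c₂) * (p₃ * x) ∎
      where
      swap : ∀ c₂ m p₂ w → c₂ * (m * (p₂ * w)) ≡ m * (p₂ * c₂) * w
      swap = solve-∀

    lower≡ : lower i q u h ≡ S * Left u v w x
    lower≡ = trans
      (cong₂ (λ y z → p₁ * p₂ * p₃ * c₁ * c₂ * (y * y * (u * z)) + p₁ * p₁ * p₃ * c₂ * (u * u * (z * z))) (sym v≡) a₂≡)
      (expand p₁ p₂ p₃ c₁ c₂ u v w)
      where
      expand : ∀ p₁ p₂ p₃ c₁ c₂ u v w →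
        p₁ * p₂ * p₃ * c₁ * c₂ * (p₁ * v * (p₁ * v) * (u * (p₁ * c₁ * (p₂ * w))))
          + p₁ * p₁ * p₃ * c₂ * (u * u * (p₁ * c₁ * (p₂ * w) * (p₁ * c₁ * (p₂ * w))))
        ≡ p₁ * p₁ * p₁ * p₁ * p₂ * p₂ * p₃ * c₁ * c₁ * c₂ * (v * v * (u * w) + u * u * (w * w))
      expand = solve-∀

    upper≡ : upper i q u h ≡ S * Right u v w x
    upper≡ = trans
      (cong₂ (λ y z → p₂ * p₂ * p₃ * c₁ * c₁ * c₂ * (y * y * (y * y)) + p₁ * p₁ * p₂ * c₁ * (u * u * (y * z))) (sym v≡) a₃≡)
      (expand p₁ p₂ p₃ c₁ c₂ u v x)
      where
      expand : ∀ p₁ p₂ p₃ c₁ c₂ u v x →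
        p₂ * p₂ * p₃ * c₁ * c₁ * c₂ * (p₁ * v * (p₁ * v) * (p₁ * v * (p₁ * v)))
          + p₁ * p₁ * p₂ * c₁ * (u * u * (p₁ * v * (p₁ * c₁ * (p₂ * c₂) * (p₃ * x))))
        ≡ p₁ * p₁ * p₁ * p₁ * p₂ * p₂ * p₃ * c₁ * c₁ * c₂ * (v * v * (v * v) + u * u * (v * x))
      expand = solve-∀

  module NumeratorScaling (m i q : ℕ) where
    scaled-numerator-suc : ∀ q → suc q * (m * numerator i (suc q)) ≡ next-N i q (m * numerator i q) (m * excess i q)
    scaled-numerator-suc q = trans (x∙yz≈y∙xz (suc q) m (numerator i (suc q)))
      (trans (cong (m *_) (numerator-suc i q)) (next-N-scale i q m (numerator i q) (excess i q)))

    scaled-excess-suc : ∀ q → suc q * c i q * (m * excess i (suc q)) ≡ next-h i q (m * numerator i q) (m * excess i q)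
    scaled-excess-suc q = trans (x∙yz≈y∙xz (suc q * c i q) m (excess i (suc q)))
      (trans (cong (m *_) (excess-suc i q)) (next-h-scale i q m (numerator i q) (excess i q)))

    -- Both recurrences are linear in N and h, so the multiples by `m` satisfy them too.
    open Scaling i q
      (m * numerator i q) (m * numerator i (1 + q)) (m * numerator i (2 + q)) (m * numerator i (3 + q))
      (m * excess i q) (m * excess i (1 + q)) (m * excess i (2 + q))
      (scaled-numerator-suc q) (scaled-excess-suc q) (scaled-numerator-suc (1 + q)) (scaled-excess-suc (1 + q))
      (scaled-numerator-suc (2 + q)) public

  Left-scale : ∀ m u v w x → Left (m * u) (m * v) (m * w) (m * x) ≡ m * m * (m * m) * Left u v w x
  Left-scale m u v w x = expanded m u v w
    where
    expanded : ∀ m u v w →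
      m * v * (m * v) * (m * u * (m * w)) + m * u * (m * u) * (m * w * (m * w))
      ≡ m * m * (m * m) * (v * v * (u * w) + u * u * (w * w))
    expanded = solve-∀

  Right-scale : ∀ m u v w x → Right (m * u) (m * v) (m * w) (m * x) ≡ m * m * (m * m) * Right u v w x
  Right-scale m u v w x = expanded m u v x
    where
    expanded : ∀ m u v x →
      m * v * (m * v) * (m * v * (m * v)) + m * u * (m * u) * (m * v * (m * x))
      ≡ m * m * (m * m) * (v * v * (v * v) + u * u * (v * x))
    expanded = solve-∀

  1≤n⁴ : ∀ n .{{_ : NonZero n}} → 1 ≤ n * n * (n * n)
  1≤n⁴ n@(suc _) = s≤s z≤n

  -- The factor `M i q` on all four numerators comes out as a fourth power and is cancelled together
  -- with `S`.
  numerator-Left<Right : ∀ j q → let i = suc j in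
    Left (numerator i q) (numerator i (1 + q)) (numerator i (2 + q)) (numerator i (3 + q))
    < Right (numerator i q) (numerator i (1 + q)) (numerator i (2 + q)) (numerator i (3 + q))
  numerator-Left<Right j q = *-cancelˡ-< (S * (m * m * (m * m))) _ _ (begin-strict
    S * (m * m * (m * m)) * Left N₀ N₁ N₂ N₃              ≡⟨ trans (*-assoc S (m * m * (m * m)) (Left N₀ N₁ N₂ N₃)) (cong (S *_) (sym (Left-scale m N₀ N₁ N₂ N₃))) ⟩
    S * Left (m * N₀) (m * N₁) (m * N₂) (m * N₃)          ≡⟨ lower≡ ⟨
    lower i q (m * N₀) (m * h)                            ≡⟨ cong (lower i q (m * N₀)) mh ⟩
    -- `N₀` is nonzero, so `1 ≤ N₀⁴`; adding the same term to both sides yields a successor on the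
    -- left, which is the strict inequality.
    lower i q (m * N₀) (2 * i * i * N₀ + e)               <⟨ +-monoˡ-≤ (lower i q (m * N₀) (2 * i * i * N₀ + e)) (1≤n⁴ N₀ {{numerator≢0 i q}}) ⟩
    N₀ * N₀ * (N₀ * N₀) + lower i q (m * N₀) (2 * i * i * N₀ + e)  ≤⟨ quartic-positive j q N₀ e ⟩
    upper i q (m * N₀) (2 * i * i * N₀ + e)               ≡⟨ cong (upper i q (m * N₀)) mh ⟨
    upper i q (m * N₀) (m * h)                            ≡⟨ upper≡ ⟩
    S * Right (m * N₀) (m * N₁) (m * N₂) (m * N₃)         ≡⟨ trans (*-assoc S (m * m * (m * m)) (Right N₀ N₁ N₂ N₃)) (cong (S *_) (sym (Right-scale m N₀ N₁ N₂ N₃))) ⟨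
    S * (m * m * (m * m)) * Right N₀ N₁ N₂ N₃             ∎)
    where
    open ≤-Reasoning
    i = suc j
    m = M i q
    open NumeratorScaling m i q
    N₀ = numerator i q
    N₁ = numerator i (1 + q)
    N₂ = numerator i (2 + q)
    N₃ = numerator i (3 + q)
    h = excess i q
    e = m * h ∸ 2 * i * i * N₀
    mh : m * h ≡ 2 * i * i * N₀ + e
    mh = sym (m+[n∸m]≡n (excess-lower-bound i q))

  numerator₀-Right<Left : ∀ q →
    Right (numerator 0 q) (numerator 0 (1 + q)) (numerator 0 (2 + q)) (numerator 0 (3 + q))
    < Left (numerator 0 q) (numerator 0 (1 + q)) (numerator 0 (2 + q)) (numerator 0 (3 + q))
  numerator₀-Right<Left q = *-cancelˡ-< S _ _ (begin-strict
    S * Right N₀ N₁ N₂ N₃                   ≡⟨ upper≡ ⟨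
    upper 0 q N₀ (excess 0 q)               ≡⟨ cong (upper 0 q N₀) (excess-0 q) ⟩
    upper 0 q N₀ 0                          <⟨ +-monoˡ-≤ (upper 0 q N₀ 0) (1≤n⁴ N₀ {{numerator≢0 0 q}}) ⟩
    N₀ * N₀ * (N₀ * N₀) + upper 0 q N₀ 0    ≤⟨ quartic-negative q N₀ ⟩
    lower 0 q N₀ 0                          ≡⟨ cong (lower 0 q N₀) (excess-0 q) ⟨
    lower 0 q N₀ (excess 0 q)               ≡⟨ lower≡ ⟩
    S * Left N₀ N₁ N₂ N₃                    ∎)
    where
    open ≤-Reasoning
    N₀ = numerator 0 q
    N₁ = numerator 0 (1 + q)
    N₂ = numerator 0 (2 + q)
    N₃ = numerator 0 (3 + q)
    open Scaling 0 q N₀ N₁ N₂ N₃ (excess 0 q) (excess 0 (1 + q)) (excess 0 (2 + q))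
      (numerator-suc 0 q) (excess-suc 0 q) (numerator-suc 0 (1 + q)) (excess-suc 0 (1 + q)) (numerator-suc 0 (2 + q))

-- From natural numerators to the rational Boros-Moll numbers.

module Transfer where
  open import Data.Integer.Base as ℤ using (+_)
  import Data.Integer.Properties as ℤ
  open import Data.List.Base using (map; upTo; _∷ʳ_)
  open import Data.List.Properties using (map-++; upTo-∷ʳ)
  open import Data.Nat.Base as ℕ using (ℕ; zero; suc; _∸_)
  open import Data.Nat.Combinatorics using (_C_)
  open import Data.Nat.ListAction using (sum)
  open import Data.Nat.ListAction.Properties using (sum-++)
  import Data.Nat.Properties as ℕ
  open import Data.Rational.Base
  open import Data.Rational.Literals using (fromℤ)
  open import Data.Rational.Properties
  open import Data.Rational.Solver using (module +-*-Solver)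
  open import Data.Rational.Unnormalised.Base as ℚᵘ using (*≡*)
  import Data.Rational.Unnormalised.Properties as ℚᵘ
  open import Relation.Binary.PropositionalEquality
  open import Defs
  open Binomials
  open Recurrence
  open NumeratorInequality

  ι : ℕ → ℚ
  ι n = fromℤ (+ n)

  ι-+ : ∀ m n → ι (m ℕ.+ n) ≡ ι m + ι n
  ι-+ m n = toℚᵘ-injective (ℚᵘ.≃-trans (*≡* eq) (ℚᵘ.≃-sym (toℚᵘ-homo-+ (ι m) (ι n))))
    where
    eq : + (m ℕ.+ n) ℤ.* + 1 ≡ (+ m ℤ.* + 1 ℤ.+ + n ℤ.* + 1) ℤ.* + 1
    eq = cong (ℤ._* + 1) (cong₂ ℤ._+_ (sym (ℤ.*-identityʳ (+ m))) (sym (ℤ.*-identityʳ (+ n))))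

  ι-* : ∀ m n → ι (m ℕ.* n) ≡ ι m * ι n
  ι-* m n = toℚᵘ-injective (ℚᵘ.≃-trans (*≡* (cong (ℤ._* + 1) (ℤ.pos-* m n))) (ℚᵘ.≃-sym (toℚᵘ-homo-* (ι m) (ι n))))

  ι-mono-< : ∀ {m n} → m ℕ.< n → ι m < ι n
  ι-mono-< {m} {n} m<n = *<* (subst₂ ℤ._<_ (sym (ℤ.*-identityʳ (+ m))) (sym (ℤ.*-identityʳ (+ n))) (ℤ.+<+ m<n))

  toℚᵘ-/ : ∀ z n .{{_ : ℕ.NonZero n}} → toℚᵘ (z / n) ℚᵘ.≃ z ℚᵘ./ n
  toℚᵘ-/ z n@(suc _) = toℚᵘ-fromℚᵘ (z ℚᵘ./ n)

  /≡ι*1/ : ∀ m n .{{_ : ℕ.NonZero n}} → + m / n ≡ ι m * (+ 1 / n)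
  /≡ι*1/ m n@(suc n-1) = toℚᵘ-injective (begin
    toℚᵘ (+ m / n)                   ≈⟨ toℚᵘ-/ (+ m) n ⟩
    + m ℚᵘ./ n                       ≈⟨ *≡* (eq) ⟩
    toℚᵘ (ι m) ℚᵘ.* (+ 1 ℚᵘ./ n)     ≈⟨ ℚᵘ.*-congˡ {toℚᵘ (ι m)} (toℚᵘ-/ (+ 1) n) ⟨
    toℚᵘ (ι m) ℚᵘ.* toℚᵘ (+ 1 / n)   ≈⟨ toℚᵘ-homo-* (ι m) (+ 1 / n) ⟨
    toℚᵘ (ι m * (+ 1 / n))           ∎)
    where
    open import Relation.Binary.Reasoning.Setoid ℚᵘ.≃-setoid
    eq : + m ℤ.* + (1 ℕ.* n) ≡ + m ℤ.* + 1 ℤ.* + n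
    eq = trans (cong (λ z → + m ℤ.* + z) (ℕ.*-identityˡ n)) (cong (ℤ._* + n) (sym (ℤ.*-identityʳ (+ m))))

  1/-* : ∀ m n .{{_ : ℕ.NonZero m}} .{{_ : ℕ.NonZero n}} .{{_ : ℕ.NonZero (m ℕ.* n)}} →
    + 1 / (m ℕ.* n) ≡ (+ 1 / m) * (+ 1 / n)
  1/-* m@(suc _) n@(suc _) = toℚᵘ-injective (begin
    toℚᵘ (+ 1 / (m ℕ.* n))                   ≈⟨ toℚᵘ-/ (+ 1) (m ℕ.* n) ⟩
    (+ 1 ℚᵘ./ m) ℚᵘ.* (+ 1 ℚᵘ./ n)           ≈⟨ ℚᵘ.*-cong (toℚᵘ-/ (+ 1) m) (toℚᵘ-/ (+ 1) n) ⟨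
    toℚᵘ (+ 1 / m) ℚᵘ.* toℚᵘ (+ 1 / n)       ≈⟨ toℚᵘ-homo-* (+ 1 / m) (+ 1 / n) ⟨
    toℚᵘ ((+ 1 / m) * (+ 1 / n))             ∎)
    where open import Relation.Binary.Reasoning.Setoid ℚᵘ.≃-setoid


  module Homogeneous (a b c e : ℕ) (t k : ℚ) where
    -- Every monomial on either side has the same weight `W`, that is t⁴k⁴. With `z` collecting the
    -- subtracted monomials of both sides, each side becomes a multiple of `W` plus the common `z`.
    u v w x W z : ℚ
    u = ι a * t
    v = ι b * (t * k)
    w = ι c * (t * k * k)
    x = ι e * (t * k * k * k)
    W = t * t * (t * t) * (k * k * (k * k))
    z = - ((ι b * ι b * (ι a * ι c) + ι a * ι a * (ι b * ι e)) * W)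

    ι-product : ∀ m n o p → ι (m ℕ.* n ℕ.* (o ℕ.* p)) ≡ ι m * ι n * (ι o * ι p)
    ι-product m n o p = trans (ι-* (m ℕ.* n) (o ℕ.* p)) (cong₂ _*_ (ι-* m n) (ι-* o p))

    left≡ : u ² * (w ² - v * x) ≡ ι (Left a b c e) * W + z
    left≡ = trans (expand (ι a) (ι b) (ι c) (ι e) t k)
      (cong (λ y → y * W + z) (sym (trans (ι-+ (b ℕ.* b ℕ.* (a ℕ.* c)) (a ℕ.* a ℕ.* (c ℕ.* c)))
        (cong₂ _+_ (ι-product b b a c) (ι-product a a c c)))))
      where
      open +-*-Solver
      expand : ∀ a b c e t k →
        (a * t) * (a * t) * ((c * (t * k * k)) * (c * (t * k * k)) - (b * (t * k)) * (e * (t * k * k * k)))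
        ≡ (b * b * (a * c) + a * a * (c * c)) * (t * t * (t * t) * (k * k * (k * k)))
          + - ((b * b * (a * c) + a * a * (b * e)) * (t * t * (t * t) * (k * k * (k * k))))
      expand = solve 6 (λ a b c e t k →
        (a :* t) :* (a :* t) :* ((c :* (t :* k :* k)) :* (c :* (t :* k :* k)) :- (b :* (t :* k)) :* (e :* (t :* k :* k :* k)))
        := (b :* b :* (a :* c) :+ a :* a :* (c :* c)) :* (t :* t :* (t :* t) :* (k :* k :* (k :* k)))
          :+ :- ((b :* b :* (a :* c) :+ a :* a :* (b :* e)) :* (t :* t :* (t :* t) :* (k :* k :* (k :* k))))) refl

    right≡ : v ² * (v ² - u * w) ≡ ι (Right a b c e) * W + z
    right≡ = trans (expand (ι a) (ι b) (ι c) (ι e) t k)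
      (cong (λ y → y * W + z) (sym (trans (ι-+ (b ℕ.* b ℕ.* (b ℕ.* b)) (a ℕ.* a ℕ.* (b ℕ.* e)))
        (cong₂ _+_ (ι-product b b b b) (ι-product a a b e)))))
      where
      open +-*-Solver
      expand : ∀ a b c e t k →
        (b * (t * k)) * (b * (t * k)) * ((b * (t * k)) * (b * (t * k)) - (a * t) * (c * (t * k * k)))
        ≡ (b * b * (b * b) + a * a * (b * e)) * (t * t * (t * t) * (k * k * (k * k)))
          + - ((b * b * (a * c) + a * a * (b * e)) * (t * t * (t * t) * (k * k * (k * k))))
      expand = solve 6 (λ a b c e t k →
        (b :* (t :* k)) :* (b :* (t :* k)) :* ((b :* (t :* k)) :* (b :* (t :* k)) :- (a :* t) :* (c :* (t :* k :* k)))
        := (b :* b :* (b :* b) :+ a :* a :* (b :* e)) :* (t :* t :* (t :* t) :* (k :* k :* (k :* k)))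
          :+ :- ((b :* b :* (a :* c) :+ a :* a :* (b :* e)) :* (t :* t :* (t :* t) :* (k :* k :* (k :* k))))) refl

    module _ {{_ : Positive t}} {{_ : Positive k}} where
      mono : ∀ {m n} → m ℕ.< n → ι m * W + z < ι n * W + z
      mono m<n = +-monoˡ-< z (*-monoˡ-<-pos W (ι-mono-< m<n))
        where
        instance
          _ = pos*pos⇒pos t t
          _ = pos*pos⇒pos (t * t) (t * t)
          _ = pos*pos⇒pos k k
          _ = pos*pos⇒pos (k * k) (k * k)
          _ = pos*pos⇒pos (t * t * (t * t)) (k * k * (k * k))

      left<right : Left a b c e ℕ.< Right a b c e → u ² * (w ² - v * x) < v ² * (v ² - u * w)
      left<right L<R = subst₂ _<_ (sym left≡) (sym right≡) (mono L<R)

      right<left : Right a b c e ℕ.< Left a b c e → v ² * (v ² - u * w) < u ² * (w ² - v * x)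
      right<left R<L = subst₂ _<_ (sym right≡) (sym left≡) (mono R<L)

  sum-upTo : ∀ (f : ℕ → ℕ) n → sum (map f (upTo n)) ≡ ∑< n f
  sum-upTo f zero    = refl
  sum-upTo f (suc n) = begin
    sum (map f (upTo (suc n)))            ≡⟨ cong (λ xs → sum (map f xs)) (upTo-∷ʳ n) ⟨
    sum (map f (upTo n ∷ʳ n))             ≡⟨ cong sum (map-++ f (upTo n) _) ⟩
    sum (map f (upTo n) ∷ʳ f n)           ≡⟨ sum-++ (map f (upTo n)) _ ⟩
    sum (map f (upTo n)) ℕ.+ (f n ℕ.+ 0)  ≡⟨ cong₂ ℕ._+_ (sum-upTo f n) (ℕ.+-identityʳ (f n)) ⟩
    ∑< n f ℕ.+ f n                        ∎
    where open ≡-Reasoning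

  ∑<-cong : ∀ {f g : ℕ → ℕ} n → (∀ l → f l ≡ g l) → ∑< n f ≡ ∑< n g
  ∑<-cong zero    f≗g = refl
  ∑<-cong (suc n) f≗g = cong₂ ℕ._+_ (∑<-cong n f≗g) (f≗g n)

  -- A copy, under an accessible name, of the local `term` of `d`, with which it agrees by
  -- definition.
  borosMollTerm : (i m k : ℕ) → ℕ
  borosMollTerm i m k = 2 ℕ.^ k ℕ.* ((2 ℕ.* m ∸ 2 ℕ.* k) C (m ∸ k)) ℕ.* ((m ℕ.+ k) C k) ℕ.* (k C i)

  -- The substitution k = l + i. The truncated differences reduce to `q ∸ l` for every `l`, even
  -- beyond q, so the terms agree at all indices, as `∑<-cong` demands.
  borosMollTerm≡summand : ∀ i q l → borosMollTerm i (q ℕ.+ i) (i ℕ.+ l) ≡ summand i q l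
  borosMollTerm≡summand i q l = begin
    borosMollTerm i m (i ℕ.+ l)   ≡⟨ cong (borosMollTerm i m) (ℕ.+-comm i l) ⟩
    borosMollTerm i m k           ≡⟨ cong₂ (λ x y → 2 ℕ.^ k ℕ.* x ℕ.* y ℕ.* (k C i)) centre (sym (binomial≡C m k)) ⟩
    2 ℕ.^ k ℕ.* central (q ∸ l) ℕ.* binomial m k ℕ.* (k C i)  ≡⟨ cong (2 ℕ.^ k ℕ.* central (q ∸ l) ℕ.* binomial m k ℕ.*_) (sym (binomial≡C l i)) ⟩
    summand i q l                 ∎
    where
    open ≡-Reasoning
    m = q ℕ.+ i
    k = l ℕ.+ i
    m∸k≡q∸l : m ∸ k ≡ q ∸ l
    m∸k≡q∸l = trans (cong₂ _∸_ (ℕ.+-comm q i) (ℕ.+-comm l i)) (ℕ.[m+n]∸[m+o]≡n∸o i q l)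
    centre : (2 ℕ.* m ∸ 2 ℕ.* k) C (m ∸ k) ≡ central (q ∸ l)
    centre = begin
      (2 ℕ.* m ∸ 2 ℕ.* k) C (m ∸ k)      ≡⟨ cong (_C (m ∸ k)) (ℕ.*-distribˡ-∸ 2 m k) ⟨
      (2 ℕ.* (m ∸ k)) C (m ∸ k)          ≡⟨ cong (λ j → (2 ℕ.* j) C j) m∸k≡q∸l ⟩
      (2 ℕ.* (q ∸ l)) C (q ∸ l)          ≡⟨ cong (λ j → (q ∸ l ℕ.+ j) C (q ∸ l)) (ℕ.+-identityʳ (q ∸ l)) ⟩
      (q ∸ l ℕ.+ (q ∸ l)) C (q ∸ l)      ≡⟨ binomial≡C (q ∸ l) (q ∸ l) ⟨
      central (q ∸ l)                    ∎

  numerator-spec : ∀ i q → ∑[ i ⋯ q ℕ.+ i ] (borosMollTerm i (q ℕ.+ i)) ≡ numerator i q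
  numerator-spec i q = begin
    sum (map f (upTo (suc q ℕ.+ i ∸ i)))  ≡⟨ cong (λ n → sum (map f (upTo n))) (ℕ.m+n∸n≡m (suc q) i) ⟩
    sum (map f (upTo (suc q)))            ≡⟨ sum-upTo f (suc q) ⟩
    ∑< (suc q) f                          ≡⟨ ∑<-cong (suc q) (borosMollTerm≡summand i q) ⟩
    numerator i q                         ∎
    where
    open ≡-Reasoning
    f : ℕ → ℕ
    f l = borosMollTerm i (q ℕ.+ i) (i ℕ.+ l)

  4⁻ : ℕ → ℚ
  4⁻ m = _/_ (+ 1) (2 ℕ.^ (2 ℕ.* m)) {{ℕ.m^n≢0 2 (2 ℕ.* m)}}

  4⁻-positive : ∀ m → Positive (4⁻ m)
  4⁻-positive m = normalize-pos 1 (2 ℕ.^ (2 ℕ.* m)) {{ℕ.m^n≢0 2 (2 ℕ.* m)}}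

  4⁻-suc : ∀ m → 4⁻ (suc m) ≡ 4⁻ m * (+ 1 / 4)
  4⁻-suc m = trans (/-cong {+ 1} {{power-suc≢0}} {{product≢0}} refl pow) (1/-* (2 ℕ.^ (2 ℕ.* m)) 4)
    where
    instance
      power≢0 = ℕ.m^n≢0 2 (2 ℕ.* m)
      power-suc≢0 = ℕ.m^n≢0 2 (2 ℕ.* suc m)
      product≢0 = ℕ.m*n≢0 (2 ℕ.^ (2 ℕ.* m)) 4
    pow : 2 ℕ.^ (2 ℕ.* suc m) ≡ 2 ℕ.^ (2 ℕ.* m) ℕ.* 4
    pow = trans (cong (2 ℕ.^_) (trans (ℕ.*-suc 2 m) (ℕ.+-comm 2 (2 ℕ.* m)))) (ℕ.^-distribˡ-+-* 2 (2 ℕ.* m) 2)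

  d≡ : ∀ i q → d i (q ℕ.+ i) ≡ ι (numerator i q) * 4⁻ (q ℕ.+ i)
  d≡ i q = trans (cong (λ N → + N / 2 ℕ.^ (2 ℕ.* (q ℕ.+ i))) (numerator-spec i q)) (/≡ι*1/ (numerator i q) (2 ℕ.^ (2 ℕ.* (q ℕ.+ i))))
    where instance _ = ℕ.m^n≢0 2 (2 ℕ.* (q ℕ.+ i))

  substitute : ∀ (P : ℚ → ℚ → ℚ → ℚ → Set) {u u′ v v′ w w′ x x′} →
    u ≡ u′ → v ≡ v′ → w ≡ w′ → x ≡ x′ → P u′ v′ w′ x′ → P u v w x
  substitute P refl refl refl refl p = p

  -- Abstracting the relation `P` serves both directions of the inequality. The index `m` comes with
  -- an equation: once that is `refl`, `m ∸ 1` computes to `q + i`, while `m + 1` and `m + 2` still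
  -- have to be commuted.
  d-transfer : ∀ i q (P : ℚ → ℚ → ℚ → ℚ → Set) → let t = 4⁻ (q ℕ.+ i) ; k = + 1 / 4 in
    P (ι (numerator i q) * t) (ι (numerator i (1 ℕ.+ q)) * (t * k))
      (ι (numerator i (2 ℕ.+ q)) * (t * k * k)) (ι (numerator i (3 ℕ.+ q)) * (t * k * k * k)) →
    ∀ m → m ≡ suc (q ℕ.+ i) → P (d i (m ∸ 1)) (d i m) (d i (m ℕ.+ 1)) (d i (m ℕ.+ 2))
  d-transfer i q P p m refl = substitute P (d≡ i q)
    (trans (d≡ i (1 ℕ.+ q)) (cong (ι (numerator i (1 ℕ.+ q)) *_) t₁))
    (trans (cong (d i) (ℕ.+-comm (suc n) 1)) (trans (d≡ i (2 ℕ.+ q)) (cong (ι (numerator i (2 ℕ.+ q)) *_) t₂)))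
    (trans (cong (d i) (ℕ.+-comm (suc n) 2)) (trans (d≡ i (3 ℕ.+ q)) (cong (ι (numerator i (3 ℕ.+ q)) *_) t₃)))
    p
    where
    n = q ℕ.+ i
    k = + 1 / 4
    t₁ : 4⁻ (1 ℕ.+ n) ≡ 4⁻ n * k
    t₁ = 4⁻-suc n
    t₂ : 4⁻ (2 ℕ.+ n) ≡ 4⁻ n * k * k
    t₂ = trans (4⁻-suc (1 ℕ.+ n)) (cong (_* k) t₁)
    t₃ : 4⁻ (3 ℕ.+ n) ≡ 4⁻ n * k * k * k
    t₃ = trans (4⁻-suc (2 ℕ.+ n)) (cong (_* k) t₂)

-- The two inequalities for Boros-Moll numbers.

open import Defs
open import Data.Integer.Base using (+_)
open import Data.Nat.Base using (ℕ; suc; _+_; _∸_; _≥_)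
open import Data.Nat.Properties using (+-comm; +-suc; m∸n+n≡m)
open import Data.Product.Base using (_×_; _,_)
open import Data.Rational.Base using (_*_; _-_; _<_; _>_; _/_)
open import Relation.Binary.PropositionalEquality using (_≡_; cong; module ≡-Reasoning)
open Recurrence using (numerator)
open NumeratorInequality using (numerator-Left<Right; numerator₀-Right<Left)
open Transfer using (4⁻; 4⁻-positive; d-transfer; module Homogeneous)

m≡1+q+i : ∀ i {m} → m ≥ i + 1 → m ≡ suc (m ∸ (i + 1) + i)
m≡1+q+i i {m} m≥i+1 = begin
  m                          ≡⟨ m∸n+n≡m m≥i+1 ⟨
  m ∸ (i + 1) + (i + 1)      ≡⟨ cong (λ z → m ∸ (i + 1) + z) (+-comm i 1) ⟩
  m ∸ (i + 1) + suc i        ≡⟨ +-suc (m ∸ (i + 1)) i ⟩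
  suc (m ∸ (i + 1) + i)      ∎
  where open ≡-Reasoning

theorem1p3 : ((i m : ℕ) → i ≥ 1 → m ≥ i + 1 →
    d i m ² * (d i m ² - d i (m ∸ 1) * d i (m + 1))
    > d i (m ∸ 1) ² * (d i (m + 1) ² - d i m * d i (m + 2)))
    × ((m : ℕ) → m ≥ 1 →
    d 0 m ² * (d 0 m ² - d 0 (m ∸ 1) * d 0 (m + 1))
    < d 0 (m ∸ 1) ² * (d 0 (m + 1) ² - d 0 m * d 0 (m + 2)))
theorem1p3 = partA , partB
  where
  partA : (i m : ℕ) → i ≥ 1 → m ≥ i + 1 →
    d i m ² * (d i m ² - d i (m ∸ 1) * d i (m + 1))
    > d i (m ∸ 1) ² * (d i (m + 1) ² - d i m * d i (m + 2))
  partA i@(suc j) m _ m≥i+1 = d-transfer i q (λ u v w x → v ² * (v ² - u * w) > u ² * (w ² - v * x))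
    (Homogeneous.left<right (numerator i q) (numerator i (1 + q)) (numerator i (2 + q)) (numerator i (3 + q))
      (4⁻ (q + i)) (+ 1 / 4) {{4⁻-positive (q + i)}} (numerator-Left<Right j q))
    m (m≡1+q+i i m≥i+1)
    -- The lowest index involved is m - 1, so it is m - 1 that equals q + i.
    where q = m ∸ (i + 1)

  partB : (m : ℕ) → m ≥ 1 →
    d 0 m ² * (d 0 m ² - d 0 (m ∸ 1) * d 0 (m + 1))
    < d 0 (m ∸ 1) ² * (d 0 (m + 1) ² - d 0 m * d 0 (m + 2))
  partB m m≥1 = d-transfer 0 q (λ u v w x → v ² * (v ² - u * w) < u ² * (w ² - v * x))
    (Homogeneous.right<left (numerator 0 q) (numerator 0 (1 + q)) (numerator 0 (2 + q)) (numerator 0 (3 + q))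
      (4⁻ (q + 0)) (+ 1 / 4) {{4⁻-positive (q + 0)}} (numerator₀-Right<Left q))
    m (m≡1+q+i 0 m≥1)
    where q = m ∸ 1
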